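{- Let $h\ge 2$. The map $f$ that sends a bargraph of width $h-1$ to the envelope of its stretched bargraph is a bijection from the set of bargraphs of width $h-1$ to the set of bubbles of width $h$.
   Context: Cells are unit squares of the square lattice, adjacent when they share an edge. A snake is a finite edge-connected set of cells, up to translation, whose adjacency graph has no cycle and all degrees at most two (so it is a path); it is partially directed if its cells can be listed from one end (tail) to the other (head) with every step North, East or West. Bargraph (rotated by 90 degrees): a polyomino formed by consecutive rows, from bottom to top, of lengths $a_1,\dots,a_m\ge 1$ ($m\ge 1$), where every row is a horizontal run of cells whose rightmost cell lies in one common column (all rows are right-justified against a vertical line). Its width is $\max_i a_i$. A well of height $k\ge 1$ is a maximal block of $k$ consecutive rows of the same length $h_1$ such that the row immediately below the block and the row immediately above it both exist and have lengths $h_0,h_2$ with $h_0>h_1<h_2$. The stretched bargraph is obtained by increasing the height of each well by two, i.e. inserting two additional rows of the same length in each well. The envelope of a (stretched) bargraph is the set of cells not in the bargraph that have a side or corner contact with it, excluding all cells lying to the right of the vertical line against which the rows are justified. Bubble of width $h$ (here with tail and head on the right): a partially directed snake whose tail and head lie in the same column, all of whose other cells lie in the $h-1$ columns immediately to the left of that column, and which has at least one cell in the leftmost of these $h-1$ columns. Bargraphs and bubbles are considered up to translation. -}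

module Defs where

open import Data.Bool.Base using (if_then_else_)
open import Data.Fin.Base using (Fin; toℕ)
open import Data.Integer.Base as ℤ using (ℤ; +_; -_; 0ℤ; 1ℤ; -1ℤ; ∣_∣)
open import Data.List.Base as List
  using (List; []; _∷_; _∷ʳ_; foldr; length; lookup)
open import Data.List.Membership.Propositional using (_∈_)
open import Data.List.NonEmpty.Base using (List⁺; _∷_; toList)
open import Data.List.Relation.Unary.All using (All)
open import Data.List.Relation.Unary.First using (First; [_]; _∷_)
open import Data.List.Relation.Unary.Linked using (Linked)
open import Data.List.Relation.Unary.Unique.Propositional using (Unique)
open import Data.Maybe.Base using (just)
open import Data.Nat.Base using (ℕ; _+_; _∸_; _≤_; _<_; _⊔_)
open import Data.Nat.Properties using (_≟_; _<?_; <-irrefl)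
open import Data.Product.Base using (Σ; ∃; ∃-syntax; _×_; _,_; proj₁; proj₂)
open import Data.Sum.Base using (_⊎_)
open import Level using (0ℓ)
open import Relation.Binary.Construct.Closure.ReflexiveTransitive using (Star)
open import Relation.Binary.PropositionalEquality using (_≡_; _≢_; refl)
open import Relation.Nullary using (¬_; Dec; yes; no; does; _×-dec_)
open import Relation.Unary using (Pred; _≐_; Satisfiable)

------------------------------------------------------------------------
-- Cells of the square lattice

-- (column , row), with columns increasing eastwards and rows northwards.
Cell : Set
Cell = ℤ × ℤ

column row : Cell → ℤ
column = proj₁
row    = proj₂

CellSet : Set₁
CellSet = Pred Cell 0ℓ

infixl 6 _⊕_
_⊕_ : Cell → Cell → Cell
(x , y) ⊕ (x′ , y′) = x ℤ.+ x′ , y ℤ.+ y′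

infix 4 _≈ₜ_
_≈ₜ_ : CellSet → CellSet → Set
P ≈ₜ Q = ∃[ v ] P ≐ (λ c → Q (c ⊕ v))

-- Sharing an edge: distance 1 in the ℓ¹ metric.
Adjacent : Cell → Cell → Set
Adjacent (x , y) (x′ , y′) = ∣ x ℤ.- x′ ∣ + ∣ y ℤ.- y′ ∣ ≡ 1

-- Sharing an edge or a corner: distance 1 in the ℓ^∞ metric.
Contact : Cell → Cell → Set
Contact (x , y) (x′ , y′) = ∣ x ℤ.- x′ ∣ ⊔ ∣ y ℤ.- y′ ∣ ≡ 1

------------------------------------------------------------------------
-- Snakes

AdjacentIn : CellSet → Cell → Cell → Set
AdjacentIn P c d = P c × P d × Adjacent c d

Finite : CellSet → Set
Finite P = ∃[ cs ] P ≐ (_∈ cs)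

Connected : CellSet → Set
Connected P = Satisfiable P × (∀ {c d} → P c → P d → Star (AdjacentIn P) c d)

record Cycle (P : CellSet) : Set where
  field
    start    : Cell
    others   : List Cell
    distinct : Unique (start ∷ others)
    long     : 3 ≤ length (start ∷ others)
    closed   : Linked (AdjacentIn P) (start ∷ others ∷ʳ start)

DegreesAtMost : ℕ → CellSet → Set
DegreesAtMost k P =
  ∀ {c} ds → Unique ds → All (AdjacentIn P c) ds → length ds ≤ k

record IsSnake (P : CellSet) : Set where
  field
    finite    : Finite P
    connected : Connected P
    acyclic   : ¬ Cycle P
    degrees   : DegreesAtMost 2 P

Step : Cell → Cell → Set
Step c d = d ≡ c ⊕ (0ℤ , 1ℤ) ⊎ d ≡ c ⊕ (1ℤ , 0ℤ) ⊎ d ≡ c ⊕ (-1ℤ , 0ℤ)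

record PartiallyDirected (P : CellSet) (tail head : Cell) : Set where
  field
    path       : List Cell
    enumerates : P ≐ (_∈ path)
    distinct   : Unique path
    steps      : Linked Step path
    first      : List.head path ≡ just tail
    last       : List.last path ≡ just head

------------------------------------------------------------------------
-- Bubbles

record IsBubble (h : ℕ) (P : CellSet) : Set where
  field
    snake             : IsSnake P
    tail head         : Cell
    partiallyDirected : PartiallyDirected P tail head
    sameColumn        : column tail ≡ column head

  leftmost : ℤ
  leftmost = column tail ℤ.- + (h ∸ 1)

  field
    otherCells : ∀ {c} → P c → c ≢ tail → c ≢ head →
                 leftmost ℤ.≤ column c × column c ℤ.< column tail
    reached    : ∃[ c ] P c × column c ≡ leftmost

Bubble : ℕ → Set₁
Bubble h = Σ CellSet (IsBubble h)

-- Bubbles are sets of cells up to translation: the choice of the data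
-- witnessing IsBubble is irrelevant.
infix 4 _≈ᵇ_
_≈ᵇ_ : ∀ {h} → Bubble h → Bubble h → Set
(P , _) ≈ᵇ (Q , _) = P ≈ₜ Q

------------------------------------------------------------------------
-- Bargraphs

-- A bargraph up to translation is the nonempty sequence of its row
-- lengths, from bottom to top.
record Bargraph (w : ℕ) : Set where
  field
    rows     : List⁺ ℕ
    positive : All (1 ≤_) (toList rows)
    width    : foldr _⊔_ 0 (toList rows) ≡ w

open Bargraph public

infix 4 _≈ᵍ_
_≈ᵍ_ : ∀ {w} → Bargraph w → Bargraph w → Set
b ≈ᵍ b′ = rows b ≡ rows b′

-- The representative whose bottom row is row 0 and whose rightmost column
-- is column 0; rows are justified against the right-hand side of column 0.
cellsOf : List⁺ ℕ → CellSet
cellsOf as (x , y) =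
  ∃[ i ] y ≡ + toℕ i × - (+ lookup (toList as) i) ℤ.< x × x ℤ.≤ 0ℤ

-- Given the length h₀ of the row just below, a row of length h₁ is the
-- bottom row of a well iff it is shorter than h₀ and the first row above
-- it whose length is not h₁ exists and is longer than h₁.
WellStarts : (h₀ h₁ : ℕ) (above : List ℕ) → Set
WellStarts h₀ h₁ above = h₁ < h₀ × First (h₁ ≡_) (h₁ <_) above

first-longer? : ∀ h₁ above → Dec (First (h₁ ≡_) (h₁ <_) above)
first-longer? h₁ []       = no λ ()
first-longer? h₁ (a ∷ as) with h₁ <? a | h₁ ≟ a
... | yes h₁<a | _        = yes [ h₁<a ]
... | no  h₁≮a | no h₁≢a  = no λ { [ h₁<a ]   → h₁≮a h₁<a
                                 ; (h₁≡a ∷ _) → h₁≢a h₁≡a }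
... | no  h₁≮a | yes refl with first-longer? h₁ as
...   | yes f = yes (refl ∷ f)
...   | no ¬f = no λ { [ h₁<h₁ ] → <-irrefl refl h₁<h₁
                     ; (_ ∷ f)   → ¬f f }

wellStarts? : ∀ h₀ h₁ above → Dec (WellStarts h₀ h₁ above)
wellStarts? h₀ h₁ above = (h₁ <? h₀) ×-dec first-longer? h₁ above

-- Each well has exactly one bottom row; tripling that row increases the
-- height of the well by two.
stretchAbove : ℕ → List ℕ → List ℕ
stretchAbove h₀ []           = []
stretchAbove h₀ (h₁ ∷ above) =
  if does (wellStarts? h₀ h₁ above)
  then h₁ ∷ h₁ ∷ h₁ ∷ stretchAbove h₁ above
  else h₁ ∷ stretchAbove h₁ above

stretch : List⁺ ℕ → List⁺ ℕ
stretch (a ∷ as) = a ∷ stretchAbove a as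

envelope : List⁺ ℕ → CellSet
envelope as c =
  ¬ cellsOf as c × (∃[ d ] cellsOf as d × Contact c d) × column c ℤ.≤ 0ℤ

f : ∀ {w} → Bargraph w → CellSet
f b = envelope (stretch (rows b))

{-# OPTIONS --safe #-}
module Submission where

-- The envelope of a bargraph is the path which, row by row, follows the
-- left boundary of the bargraph: if C is the sequence of row lengths
-- (extended by zeros), it enters row r at depth E r = C r ⊔ C (1 + r).  The
-- envelope agrees with this path when no well has height 1, and the path is
-- a snake when E has no strict local extremum, that is when no well has
-- height 1 or 2; such bargraphs are exactly the stretched ones, because a
-- stretched well has height at least 3 and its bottom three rows can be
-- merged again.  Conversely, the bargraph is recovered from the depths at
-- which a bubble moves North by C (1 + r) = E r ⊓ E (1 + r), and a strict
-- local extremum of E would close a 2 × 2 square in the bubble.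

open import Data.Empty using (⊥; ⊥-elim)
open import Data.Bool.Base using (true; false; if_then_else_)
open import Data.Fin.Base using (zero; suc; toℕ; fromℕ<)
open import Data.Fin.Properties using (toℕ-fromℕ<)
open import Data.Integer.Base as ℤ using (ℤ; +_; -_; 0ℤ; 1ℤ; -1ℤ; ∣_∣; _⊖_; -[1+_])
import Data.Integer.Properties as ℤₚ
open import Algebra.Properties.AbelianGroup ℤₚ.+-0-abelianGroup using (∙-cancelʳ)
open import Data.Integer.Tactic.RingSolver using (solve-∀)
open import Data.List.Base as List using (List; []; _∷_; _∷ʳ_; foldr; length; lookup; applyUpTo)
open import Data.List.Membership.Propositional using (_∈_)
open import Data.List.NonEmpty.Base using (List⁺; _∷_; toList)
open import Data.List.Relation.Unary.All as All using (All; []; _∷_)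
open import Data.List.Relation.Unary.All.Properties using (¬Any⇒All¬; All¬⇒¬Any; applyUpTo⁺₁)
open import Data.List.Relation.Unary.AllPairs using ([]; _∷_)
open import Data.List.Relation.Unary.Any using (here; there)
open import Data.List.Relation.Unary.First using (First; [_]; _∷_)
open import Data.List.Relation.Unary.Linked using (Linked; []; [-]; _∷_)
open import Data.List.Relation.Unary.Unique.Propositional using (Unique)
open import Data.Maybe.Base using (just)
open import Data.Maybe.Properties using (just-injective)
open import Data.List.Properties using (length-applyUpTo; ∷-injective; ∷-injectiveˡ; ∷-injectiveʳ)
open import Data.Nat.Base as ℕ
open import Data.Nat.Properties
open import Data.Product.Base using (Σ; ∃; ∃-syntax; _×_; _,_; proj₁; proj₂)
open import Data.Product.Properties using (≡-dec)
open import Data.Sum.Base using (_⊎_; inj₁; inj₂; [_,_]′)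
open import Function.Base using (_∘_; id; _$_)
open import Function.Structures using (IsBijection)
open import Relation.Binary.Construct.Closure.ReflexiveTransitive as Star using (Star; ε; _◅_; _◅◅_)
open import Relation.Binary.Definitions using (tri<; tri≈; tri>)
open import Relation.Binary.PropositionalEquality using (_≡_; _≢_; refl; sym; trans; cong; cong₂; subst; subst₂; module ≡-Reasoning)
open import Relation.Nullary using (¬_; Dec; yes; no; does; contradiction)
open import Relation.Nullary.Decidable using (dec-true; dec-false)
open import Relation.Unary using (_≐_)
open import Defs

-- Stretching

-- A well of height k leaves k - 1 equal minimal values in E. Height 1 leaves none, so the length of
-- that row is invisible in E; height 2 leaves one, a U-turn whose two arms touch. Height 3 is the
-- least that works, which is why stretching adds two rows. A maximum of neighbouring rows never has
-- a strict peak, and a minimum of neighbouring depths never has a well of height 1: these are the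
-- conditions under which the absorption laws invert the two formulas. That the path is a snake
-- reduces to one function on cells, injective on the path and changing by exactly 1 between
-- adjacent cells; there, smoothness is what controls vertical neighbours. Conversely, distinctness
-- of the cells makes a bubble monotone within each row, and the column of the tail, containing only
-- tail and head, makes the recovered row lengths positive.

first-stretchAbove⁺ : ∀ {P Q : ℕ → Set} h₀ {as} → First P Q as → First P Q (stretchAbove h₀ as)
first-stretchAbove⁺ h₀ {a ∷ as} F with does (wellStarts? h₀ a as) | F
... | true  | [ qa ]  = [ qa ]
... | true  | pa ∷ F′ = pa ∷ pa ∷ pa ∷ first-stretchAbove⁺ a F′
... | false | [ qa ]  = [ qa ]
... | false | pa ∷ F′ = pa ∷ first-stretchAbove⁺ a F′

-- Stretching only repeats entries, so with its converse this shows that a row starts a well after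
-- stretching exactly when it did before.
first-stretchAbove⁻ : ∀ {P Q : ℕ → Set} h₀ as → First P Q (stretchAbove h₀ as) → First P Q as
first-stretchAbove⁻ h₀ (a ∷ as) F with does (wellStarts? h₀ a as) | F
... | true  | [ qa ]            = [ qa ]
... | true  | _ ∷ [ qa ]        = [ qa ]
... | true  | _ ∷ _ ∷ [ qa ]    = [ qa ]
... | true  | pa ∷ _ ∷ _ ∷ F′   = pa ∷ first-stretchAbove⁻ a as F′
... | false | [ qa ]            = [ qa ]
... | false | pa ∷ F′           = pa ∷ first-stretchAbove⁻ a as F′

stretchAbove-well : ∀ {h₀ h₁ as} → WellStarts h₀ h₁ as →
                    stretchAbove h₀ (h₁ ∷ as) ≡ h₁ ∷ h₁ ∷ h₁ ∷ stretchAbove h₁ as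
stretchAbove-well {h₀} {h₁} {as} w =
  cong (λ b → if b then h₁ ∷ h₁ ∷ h₁ ∷ stretchAbove h₁ as else h₁ ∷ stretchAbove h₁ as)
       (dec-true (wellStarts? h₀ h₁ as) w)

stretchAbove-¬well : ∀ {h₀ h₁ as} → ¬ WellStarts h₀ h₁ as →
                     stretchAbove h₀ (h₁ ∷ as) ≡ h₁ ∷ stretchAbove h₁ as
stretchAbove-¬well {h₀} {h₁} {as} ¬w =
  cong (λ b → if b then h₁ ∷ h₁ ∷ h₁ ∷ stretchAbove h₁ as else h₁ ∷ stretchAbove h₁ as)
       (dec-false (wellStarts? h₀ h₁ as) ¬w)

stretchAbove-head : ∀ h₀ a as → ∃[ bs ] stretchAbove h₀ (a ∷ as) ≡ a ∷ bs
stretchAbove-head h₀ a as with wellStarts? h₀ a as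
... | yes w = _ , stretchAbove-well w
... | no ¬w = _ , stretchAbove-¬well ¬w

-- If only one of the two heads started a well, the stretched tail of the other would begin with two
-- more copies of `a` and inherit the longer row that closes the well. Pulled back through
-- `first-stretchAbove⁻`, this makes the other head start a well too.
stretchAbove-injective : ∀ h₀ as bs → stretchAbove h₀ as ≡ stretchAbove h₀ bs → as ≡ bs
stretchAbove-injective h₀ [] [] _ = refl
stretchAbove-injective h₀ [] (b ∷ bs) eq with () ← trans eq (proj₂ (stretchAbove-head h₀ b bs))
stretchAbove-injective h₀ (a ∷ as) [] eq with () ← trans (sym eq) (proj₂ (stretchAbove-head h₀ a as))
stretchAbove-injective h₀ (a ∷ as) (b ∷ bs) eq
  with refl ← ∷-injectiveˡ (trans (sym (proj₂ (stretchAbove-head h₀ a as)))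
                                  (trans eq (proj₂ (stretchAbove-head h₀ b bs))))
  with wellStarts? h₀ a as | wellStarts? h₀ a bs
... | no ¬w | no ¬v =
  cong (a ∷_) (stretchAbove-injective a as bs (∷-injectiveʳ
    (trans (sym (stretchAbove-¬well ¬w)) (trans eq (stretchAbove-¬well ¬v)))))
... | yes w | yes v =
  cong (a ∷_) (stretchAbove-injective a as bs (∷-injectiveʳ (∷-injectiveʳ (∷-injectiveʳ
    (trans (sym (stretchAbove-well w)) (trans eq (stretchAbove-well v)))))))
... | yes w@(a<h₀ , F) | no ¬v = contradiction
  (a<h₀ , first-stretchAbove⁻ a bs
    (subst (First _ _)
      (∷-injectiveʳ (trans (sym (stretchAbove-well w)) (trans eq (stretchAbove-¬well ¬v))))
      (refl ∷ refl ∷ first-stretchAbove⁺ a F)))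
  ¬v
... | no ¬w | yes v@(a<h₀ , F) = contradiction
  (a<h₀ , first-stretchAbove⁻ a as
    (subst (First _ _)
      (sym (∷-injectiveʳ (trans (sym (stretchAbove-¬well ¬w)) (trans eq (stretchAbove-well v)))))
      (refl ∷ refl ∷ first-stretchAbove⁺ a F)))
  ¬w

-- The shape of the results of `stretchAbove`. What lies above a tripled row is judged against `h₁`
-- itself, so further copies of `h₁` do not start another well.
data TallWells : ℕ → List ℕ → Set where
  []  : ∀ {h₀} → TallWells h₀ []
  ¬well : ∀ {h₀ h₁ above} → ¬ WellStarts h₀ h₁ above → TallWells h₁ above →
          TallWells h₀ (h₁ ∷ above)
  well  : ∀ {h₀ h₁ above} → WellStarts h₀ h₁ above → TallWells h₁ above →
          TallWells h₀ (h₁ ∷ h₁ ∷ h₁ ∷ above)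

stretchAbove-tallWells : ∀ h₀ as → TallWells h₀ (stretchAbove h₀ as)
stretchAbove-tallWells h₀ [] = []
stretchAbove-tallWells h₀ (h₁ ∷ as) with wellStarts? h₀ h₁ as
... | yes w@(h₁<h₀ , F) = subst (TallWells h₀) (sym (stretchAbove-well w))
  (well (h₁<h₀ , first-stretchAbove⁺ h₁ F) (stretchAbove-tallWells h₁ as))
... | no ¬w = subst (TallWells h₀) (sym (stretchAbove-¬well ¬w)) $
              ¬well (λ (h₁<h₀ , F) → ¬w (h₁<h₀ , first-stretchAbove⁻ h₁ as F))
                    (stretchAbove-tallWells h₁ as)

unstretchAbove : ∀ {h₀ bs} → TallWells h₀ bs → ∃[ as ] stretchAbove h₀ as ≡ bs
unstretchAbove [] = [] , refl
unstretchAbove (¬well {h₁ = h₁} ¬w t) with as , refl ← unstretchAbove t =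
  h₁ ∷ as , stretchAbove-¬well {as = as} (λ (h₁<h₀ , F) → ¬w (h₁<h₀ , first-stretchAbove⁺ h₁ F))
unstretchAbove (well {h₁ = h₁} (h₁<h₀ , F) t) with as , refl ← unstretchAbove t =
  h₁ ∷ as , stretchAbove-well {as = as} (h₁<h₀ , first-stretchAbove⁻ h₁ as F)

-- Junk value 0 outside the list, so the row above the topmost one is empty.
rowAt : List ℕ → ℕ → ℕ
rowAt []       _       = 0
rowAt (a ∷ as) zero    = a
rowAt (a ∷ as) (suc i) = rowAt as i

-- Bounds the heights of wells by inequalities between nearby rows only, so that it can be compared
-- with the equally local `Smooth`.
record NoShortWell (C : ℕ → ℕ) : Set where
  field
    height≢1 : ∀ i → C (1 + i) < C i → ¬ C (1 + i) < C (2 + i)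
    height≢2 : ∀ i → C (1 + i) < C i → C (1 + i) ≡ C (2 + i) → ¬ C (2 + i) < C (3 + i)

¬wellStarts-rowAt : ∀ {h₀ h₁ as} → ¬ WellStarts h₀ h₁ as → h₁ < h₀ →
  ¬ h₁ < rowAt as 0 × (h₁ ≡ rowAt as 0 → ¬ rowAt as 0 < rowAt as 1)
¬wellStarts-rowAt {as = []}         ¬w h₁<h₀ = (λ ()) , λ _ ()
¬wellStarts-rowAt {as = a ∷ []}     ¬w h₁<h₀ = (λ h₁<a → ¬w (h₁<h₀ , [ h₁<a ])) , λ _ ()
¬wellStarts-rowAt {as = a ∷ b ∷ as} ¬w h₁<h₀ =
  (λ h₁<a → ¬w (h₁<h₀ , [ h₁<a ])) , λ { refl a<b → ¬w (h₁<h₀ , refl ∷ [ a<b ]) }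

tallWells-height≢1 : ∀ {h₀ as} → TallWells h₀ as → let C = rowAt (h₀ ∷ as) in
                     ∀ i → C (1 + i) < C i → ¬ C (1 + i) < C (2 + i)
tallWells-height≢1 []           zero    _ ()
tallWells-height≢1 (¬well ¬w t) zero    l = proj₁ (¬wellStarts-rowAt ¬w l)
tallWells-height≢1 (well w t)   zero    l = <-irrefl refl
tallWells-height≢1 []           (suc i) ()
tallWells-height≢1 (¬well ¬w t) (suc i) = tallWells-height≢1 t i
tallWells-height≢1 (well w t)   1       l = contradiction l (<-irrefl refl)
tallWells-height≢1 (well w t)   2       l = contradiction l (<-irrefl refl)
tallWells-height≢1 (well w t)   (suc (suc (suc i))) = tallWells-height≢1 t i

tallWells-height≢2 : ∀ {h₀ as} → TallWells h₀ as → let C = rowAt (h₀ ∷ as) in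
  ∀ i → C (1 + i) < C i → C (1 + i) ≡ C (2 + i) → ¬ C (2 + i) < C (3 + i)
tallWells-height≢2 []           zero    _ _ ()
tallWells-height≢2 (¬well ¬w t) zero    l = proj₂ (¬wellStarts-rowAt ¬w l)
tallWells-height≢2 (well w t)   zero    l _ = <-irrefl refl
tallWells-height≢2 []           (suc i) ()
tallWells-height≢2 (¬well ¬w t) (suc i) = tallWells-height≢2 t i
tallWells-height≢2 (well w t)   1       l = contradiction l (<-irrefl refl)
tallWells-height≢2 (well w t)   2       l = contradiction l (<-irrefl refl)
tallWells-height≢2 (well w t)   (suc (suc (suc i))) = tallWells-height≢2 t i

noShortWell-tail : ∀ {C} → NoShortWell C → NoShortWell (C ∘ suc)
noShortWell-tail n = record { height≢1 = height≢1 ∘ suc ; height≢2 = height≢2 ∘ suc }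
  where open NoShortWell n

noShortWell⇒tallWells : ∀ h₀ as → NoShortWell (rowAt (h₀ ∷ as)) → TallWells h₀ as
noShortWell⇒tallWells h₀ [] n = []
noShortWell⇒tallWells h₀ (h₁ ∷ as) n with wellStarts? h₀ h₁ as
... | no ¬w = ¬well ¬w (noShortWell⇒tallWells h₁ as (noShortWell-tail n))
noShortWell⇒tallWells h₀ (h₁ ∷ a ∷ as) n | yes (h₁<h₀ , [ h₁<a ]) =
  contradiction h₁<a (NoShortWell.height≢1 n 0 h₁<h₀)
noShortWell⇒tallWells h₀ (h₁ ∷ a ∷ b ∷ as) n | yes (h₁<h₀ , refl ∷ [ a<b ]) =
  contradiction a<b (NoShortWell.height≢2 n 0 h₁<h₀ refl)
noShortWell⇒tallWells h₀ (h₁ ∷ a ∷ b ∷ as) n | yes (h₁<h₀ , refl ∷ refl ∷ F) =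
  well (h₁<h₀ , F)
    (noShortWell⇒tallWells h₁ as (noShortWell-tail (noShortWell-tail (noShortWell-tail n))))

tallWells-unground : ∀ {a as} → TallWells 0 (a ∷ as) → TallWells a as
tallWells-unground (¬well _ t)    = t
tallWells-unground (well (() , _) _)

-- Row lengths and turning depths

-- A strict local extremum is a U-turn with a single step North.
record Smooth (E : ℕ → ℕ) : Set where
  field
    noPeak : ∀ i → E i < E (1 + i) → ¬ E (2 + i) < E (1 + i)
    noDip  : ∀ i → E (1 + i) < E i → ¬ E (1 + i) < E (2 + i)

a⊔b<c⊔a⇒a<c : ∀ a b c → a ⊔ b < c ⊔ a → a < c
a⊔b<c⊔a⇒a<c a b c l with ⊔-sel c a
... | inj₁ eq = ≤-<-trans (m≤m⊔n a b) (subst (a ⊔ b <_) eq l)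
... | inj₂ eq = contradiction (≤-<-trans (m≤m⊔n a b) (subst (a ⊔ b <_) eq l)) (<-irrefl refl)

module _ {C E : ℕ → ℕ} (E≡ : ∀ i → E i ≡ C i ⊔ C (1 + i)) (C-ok : NoShortWell C) where
  open NoShortWell C-ok

  -- Peaks are impossible because the larger of `C (1 + i)` and `C (2 + i)` is also below one of the
  -- outer depths. A dip makes each of these two rows shorter than its outer neighbour, and
  -- comparing them exhibits a well of height 1 or 2.
  ⊔-smooth : Smooth E
  ⊔-smooth = record { noPeak = noPeak ; noDip = noDip }
    where
    noPeak : ∀ i → E i < E (1 + i) → ¬ E (2 + i) < E (1 + i)
    noPeak i l r rewrite E≡ i | E≡ (1 + i) | E≡ (2 + i) with ⊔-sel (C (1 + i)) (C (2 + i))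
    ... | inj₁ eq = <⇒≱ l (≤-trans (≤-reflexive eq) (m≤n⊔m (C i) _))
    ... | inj₂ eq = <⇒≱ r (≤-trans (≤-reflexive eq) (m≤m⊔n _ (C (3 + i))))

    noDip : ∀ i → E (1 + i) < E i → ¬ E (1 + i) < E (2 + i)
    noDip i l r rewrite E≡ i | E≡ (1 + i) | E≡ (2 + i)
      with c₁<c₀ ← a⊔b<c⊔a⇒a<c (C (1 + i)) (C (2 + i)) (C i) l
         | c₂<c₃ ← a⊔b<c⊔a⇒a<c (C (2 + i)) (C (1 + i)) (C (3 + i))
                     (subst₂ _<_ (⊔-comm (C (1 + i)) _) (⊔-comm (C (2 + i)) _) r)
      with <-cmp (C (1 + i)) (C (2 + i))
    ... | tri< c₁<c₂ _ _ = height≢1 i c₁<c₀ c₁<c₂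
    ... | tri≈ _ c₁≡c₂ _ = height≢2 i c₁<c₀ c₁≡c₂ c₂<c₃
    ... | tri> _ _ c₂<c₁ = height≢1 (1 + i) c₂<c₁ c₂<c₃

  -- If `C (1 + i)` is at least `C i`, this is absorption. Otherwise the absence of wells of height
  -- 1 gives `C (2 + i) ≤ C (1 + i)`, and the second depth bounds the minimum.
  ⊓-of-⊔ : ∀ i → E i ⊓ E (1 + i) ≡ C (1 + i)
  ⊓-of-⊔ i rewrite E≡ i | E≡ (1 + i) with C (1 + i) <? C i
  ... | no  c₁≮c₀ = trans (cong (_⊓ (C (1 + i) ⊔ C (2 + i))) (m≤n⇒m⊔n≡n (≮⇒≥ c₁≮c₀)))
                          (⊓-absorbs-⊔ (C (1 + i)) (C (2 + i)))
  ... | yes c₁<c₀ = trans (cong ((C i ⊔ C (1 + i)) ⊓_) (m≥n⇒m⊔n≡m (≮⇒≥ (height≢1 i c₁<c₀))))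
                          (m≥n⇒m⊓n≡n (m≤n⊔m (C i) (C (1 + i))))

module _ {C E : ℕ → ℕ} (E₀ : E 0 ≡ 0) (C₀ : C 0 ≡ 0) (C≡ : ∀ i → C (1 + i) ≡ E i ⊓ E (1 + i))
         (E-ok : Smooth E) where
  open Smooth E-ok

  -- Dual to `⊓-of-⊔`, with the absence of peaks in place of wells of height 1. Index 0 has no
  -- predecessor and is settled by both sequences starting at 0.
  ⊔-of-⊓ : ∀ i → E i ≡ C i ⊔ C (1 + i)
  ⊔-of-⊓ zero    rewrite C≡ 0 | E₀ | C₀ = refl
  ⊔-of-⊓ (suc i) rewrite C≡ i | C≡ (1 + i) with E i <? E (1 + i)
  ... | no  e₀≮e₁ = sym (trans (cong (_⊔ (E (1 + i) ⊓ E (2 + i))) (m≥n⇒m⊓n≡n (≮⇒≥ e₀≮e₁)))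
                               (⊔-absorbs-⊓ (E (1 + i)) (E (2 + i))))
  ... | yes e₀<e₁ = sym (trans (cong ((E i ⊓ E (1 + i)) ⊔_) (m≤n⇒m⊓n≡m (≮⇒≥ (noPeak i e₀<e₁))))
                               (m≤n⇒m⊔n≡n (m⊓n≤n (E i) (E (1 + i)))))

  -- Height 1 fails because the smaller of two depths also bounds a neighbouring row from above. In
  -- a well of height 2 both rows have the length of the depth between them, which is then a strict
  -- dip.
  ⊓-noShortWell : NoShortWell C
  ⊓-noShortWell = record { height≢1 = height≢1 ; height≢2 = height≢2 }
    where
    height≢1 : ∀ i → C (1 + i) < C i → ¬ C (1 + i) < C (2 + i)
    height≢1 zero    l _ rewrite C₀ = n≮0 l
    height≢1 (suc i) l r rewrite C≡ i | C≡ (1 + i) | C≡ (2 + i)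
      with ⊓-sel (E (1 + i)) (E (2 + i))
    ... | inj₁ eq = <⇒≱ l (≤-trans (m⊓n≤n (E i) _) (≤-reflexive (sym eq)))
    ... | inj₂ eq = <⇒≱ r (≤-trans (m⊓n≤m _ (E (3 + i))) (≤-reflexive (sym eq)))

    height≢2 : ∀ i → C (1 + i) < C i → C (1 + i) ≡ C (2 + i) → ¬ C (2 + i) < C (3 + i)
    height≢2 zero    l _ _ rewrite C₀ = n≮0 l
    height≢2 (suc i) l eq r rewrite C≡ i | C≡ (1 + i) | C≡ (2 + i) | C≡ (3 + i) =
      noDip (1 + i) e₂<e₁ e₂<e₃
      where
      e₁⊓e₂<e₁ : E (1 + i) ⊓ E (2 + i) < E (1 + i)
      e₁⊓e₂<e₁ = <-≤-trans l (m⊓n≤n (E i) _)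
      e₁⊓e₂≡e₂ : E (1 + i) ⊓ E (2 + i) ≡ E (2 + i)
      e₁⊓e₂≡e₂ with ⊓-sel (E (1 + i)) (E (2 + i))
      ... | inj₁ eq₁ = contradiction (subst (_< E (1 + i)) eq₁ e₁⊓e₂<e₁) (<-irrefl refl)
      ... | inj₂ eq₂ = eq₂
      e₂<e₁ : E (2 + i) < E (1 + i)
      e₂<e₁ = subst (_< E (1 + i)) e₁⊓e₂≡e₂ e₁⊓e₂<e₁
      e₂<e₃ : E (2 + i) < E (3 + i)
      e₂<e₃ = subst (_< E (3 + i)) (trans (sym eq) e₁⊓e₂≡e₂) (<-≤-trans r (m⊓n≤m _ (E (4 + i))))

-- Snakes from an index function

step⇒adjacent : ∀ c {d} → Step c d → Adjacent c d
step⇒adjacent (x , y) = λ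
  { (inj₁ refl)        → cong₂ (λ i j → ∣ i ∣ + ∣ j ∣) (i-[i+k] x 0ℤ) (i-[i+k] y 1ℤ)
  ; (inj₂ (inj₁ refl)) → cong₂ (λ i j → ∣ i ∣ + ∣ j ∣) (i-[i+k] x 1ℤ) (i-[i+k] y 0ℤ)
  ; (inj₂ (inj₂ refl)) → cong₂ (λ i j → ∣ i ∣ + ∣ j ∣) (i-[i+k] x -1ℤ) (i-[i+k] y 0ℤ)
  }
  where
  i-[i+k] : ∀ i k → i ℤ.- (i ℤ.+ k) ≡ ℤ.- k
  i-[i+k] = solve-∀

adjacentIn-sym : ∀ P c d → AdjacentIn P c d → AdjacentIn P d c
adjacentIn-sym _ (x , y) (x′ , y′) (c∈ , d∈ , adj) =
  d∈ , c∈ , trans (cong₂ _+_ (ℤₚ.∣i-j∣≡∣j-i∣ x′ x) (ℤₚ.∣i-j∣≡∣j-i∣ y′ y)) adj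

module _ {P : CellSet} {c cs} (enumerates : P ≐ (_∈ c ∷ cs)) (steps : Linked Step (c ∷ cs)) where

  linked⇒connected : Connected P
  linked⇒connected =
    (c , proj₂ enumerates (here refl)) ,
    λ d∈ e∈ → Star.reverse (λ {c} {d} → adjacentIn-sym P c d) (fromHead (proj₁ enumerates d∈)) ◅◅
              fromHead (proj₁ enumerates e∈)
    where
    walk : ∀ {d ds e} → Linked Step (d ∷ ds) → (∀ {x} → x ∈ d ∷ ds → P x) → e ∈ d ∷ ds →
           Star (AdjacentIn P) d e
    walk l       ⊆P (here refl) = ε
    walk {d} (s ∷ l) ⊆P (there e∈)  =
      (⊆P (here refl) , ⊆P (there (here refl)) , step⇒adjacent d s) ◅ walk l (⊆P ∘ there) e∈

    fromHead : ∀ {e} → e ∈ c ∷ cs → Star (AdjacentIn P) c e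
    fromHead = walk steps (proj₂ enumerates)

module _ {P : CellSet} (ρ : Cell → ℕ)
         (ρ-injective : ∀ {c d} → P c → P d → ρ c ≡ ρ d → c ≡ d)
         (ρ-adjacent : ∀ {c d} → AdjacentIn P c d → ρ d ≡ suc (ρ c) ⊎ ρ c ≡ suc (ρ d)) where

  -- The neighbours of `c` have only two possible indices, and an index determines its cell.
  indexed⇒degrees≤2 : DegreesAtMost 2 P
  indexed⇒degrees≤2 []           _ _ = z≤n
  indexed⇒degrees≤2 (_ ∷ [])     _ _ = s≤s z≤n
  indexed⇒degrees≤2 (_ ∷ _ ∷ []) _ _ = s≤s (s≤s z≤n)
  indexed⇒degrees≤2 {c} (d₁ ∷ d₂ ∷ d₃ ∷ _) ((d₁≢d₂ ∷ d₁≢d₃ ∷ _) ∷ (d₂≢d₃ ∷ _) ∷ _) (a₁ ∷ a₂ ∷ a₃ ∷ _) =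
    ⊥-elim (pigeonhole (ρ-adjacent a₁) (ρ-adjacent a₂) (ρ-adjacent a₃))
    where
    after : ∀ {d e} → AdjacentIn P c d → AdjacentIn P c e → ρ d ≡ suc (ρ c) → ρ e ≡ suc (ρ c) → d ≡ e
    after (_ , d∈ , _) (_ , e∈ , _) p q = ρ-injective d∈ e∈ (trans p (sym q))

    before : ∀ {d e} → AdjacentIn P c d → AdjacentIn P c e → ρ c ≡ suc (ρ d) → ρ c ≡ suc (ρ e) → d ≡ e
    before (_ , d∈ , _) (_ , e∈ , _) p q = ρ-injective d∈ e∈ (suc-injective (trans (sym p) q))

    Beside : Cell → Set
    Beside d = ρ d ≡ suc (ρ c) ⊎ ρ c ≡ suc (ρ d)

    pigeonhole : Beside d₁ → Beside d₂ → Beside d₃ → ⊥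
    pigeonhole (inj₁ p) (inj₁ q) _        = d₁≢d₂ (after a₁ a₂ p q)
    pigeonhole (inj₁ p) (inj₂ _) (inj₁ q) = d₁≢d₃ (after a₁ a₃ p q)
    pigeonhole (inj₁ _) (inj₂ p) (inj₂ q) = d₂≢d₃ (before a₂ a₃ p q)
    pigeonhole (inj₂ _) (inj₁ p) (inj₁ q) = d₂≢d₃ (after a₂ a₃ p q)
    pigeonhole (inj₂ p) (inj₁ _) (inj₂ q) = d₁≢d₃ (before a₁ a₃ p q)
    pigeonhole (inj₂ p) (inj₂ q) _        = d₁≢d₂ (before a₁ a₂ p q)

  -- A walk through distinct cells never turns back, so its index keeps
  -- increasing (or keeps decreasing) and it cannot close up.
  ascent : ∀ {x y s} zs → Linked (AdjacentIn P) (x ∷ y ∷ zs ∷ʳ s) → Unique (x ∷ y ∷ zs) →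
           ρ y ≡ suc (ρ x) → ρ x + length zs ≤ ρ s
  -- The closing cell `s` may coincide with `x`, so the last step may turn back; counting only `zs`
  -- in the bound allows for this.
  ascent {x} {y} {s} [] (_ ∷ a ∷ _) _ up with ρ-adjacent a
  ... | inj₁ eq = ≤-trans (≤-reflexive (+-identityʳ (ρ x)))
                    (≤-trans (n≤1+n _) (≤-trans (≤-reflexive (sym up))
                      (≤-trans (n≤1+n _) (≤-reflexive (sym eq)))))
  ... | inj₂ eq = ≤-reflexive (trans (+-identityʳ (ρ x)) (suc-injective (trans (sym up) eq)))
  ascent {x} {y} {s} (z ∷ zs) ((x∈ , _) ∷ l@(a@(_ , z∈ , _) ∷ _)) ((_ ∷ x≢z ∷ _) ∷ u) up
    with ρ-adjacent a
  ... | inj₁ eq = ≤-trans (≤-reflexive (trans (+-suc (ρ x) (length zs)) (cong (_+ length zs) (sym up))))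
                          (ascent zs l u eq)
  ... | inj₂ eq = contradiction (ρ-injective x∈ z∈ (suc-injective (trans (sym up) eq))) x≢z

  descent : ∀ {x y s} zs → Linked (AdjacentIn P) (x ∷ y ∷ zs ∷ʳ s) → Unique (x ∷ y ∷ zs) →
            ρ x ≡ suc (ρ y) → ρ s + length zs ≤ ρ x
  descent {x} {y} {s} [] (_ ∷ a ∷ _) _ down with ρ-adjacent a
  ... | inj₁ eq = ≤-reflexive (trans (+-identityʳ (ρ s)) (trans eq (sym down)))
  ... | inj₂ eq = ≤-trans (≤-reflexive (+-identityʳ (ρ s)))
                    (≤-trans (n≤1+n _) (≤-trans (≤-reflexive (sym eq))
                      (≤-trans (n≤1+n _) (≤-reflexive (sym down)))))
  descent {x} {y} {s} (z ∷ zs) ((x∈ , _) ∷ l@(a@(_ , z∈ , _) ∷ _)) ((_ ∷ x≢z ∷ _) ∷ u) down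
    with ρ-adjacent a
  ... | inj₁ eq = contradiction (ρ-injective x∈ z∈ (trans down (sym eq))) x≢z
  ... | inj₂ eq = ≤-trans (≤-reflexive (+-suc (ρ s) (length zs)))
                    (≤-trans (s≤s (descent zs l u eq)) (≤-reflexive (sym down)))

  indexed⇒acyclic : ¬ Cycle P
  indexed⇒acyclic record { others = [] ; long = s≤s () }
  indexed⇒acyclic record { others = _ ∷ [] ; long = s≤s (s≤s ()) }
  indexed⇒acyclic record { start = s ; others = y ∷ z ∷ zs ; distinct = u ; closed = l@(a ∷ _) }
    with ρ-adjacent a
  -- A cycle has at least three cells, so `z ∷ zs` is nonempty and the bound exceeds `ρ s`.
  ... | inj₁ eq = m+1+n≰m (ρ s) (ascent (z ∷ zs) l u eq)
  ... | inj₂ eq = m+1+n≰m (ρ s) (descent (z ∷ zs) l u eq)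

-- The index of a cell along the path

Between : ℕ → ℕ → ℕ → Set
Between a b p = a ⊓ b ≤ p × p ≤ a ⊔ b

-- The cells of a path which enters row r at depth E r and leaves it at
-- depth E (1 + r), for r < n.
OnPath : (ℕ → ℕ) → ℕ → ℕ → ℕ → Set
OnPath E n p r = r < n × Between (E r) (E (1 + r)) p

between-left : ∀ a b → Between a b a
between-left a b = m⊓n≤m a b , m≤m⊔n a b

between-∣-∣ : ∀ {a b p} → Between a b p → ∣ p - a ∣ ≤ ∣ a - b ∣
between-∣-∣ {a} {b} {p} (lo , hi) with ≤-total a b
... | inj₁ a≤b = begin
  ∣ p - a ∣ ≡⟨ m≤n⇒∣n-m∣≡n∸m (subst (_≤ p) (m≤n⇒m⊓n≡m a≤b) lo) ⟩
  p ∸ a     ≤⟨ ∸-monoˡ-≤ a (subst (p ≤_) (m≤n⇒m⊔n≡n a≤b) hi) ⟩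
  b ∸ a     ≡⟨ m≤n⇒∣m-n∣≡n∸m a≤b ⟨
  ∣ a - b ∣ ∎
  where open ≤-Reasoning
... | inj₂ b≤a = begin
  ∣ p - a ∣ ≡⟨ m≤n⇒∣m-n∣≡n∸m (subst (p ≤_) (m≥n⇒m⊔n≡m b≤a) hi) ⟩
  a ∸ p     ≤⟨ ∸-monoʳ-≤ a (subst (_≤ p) (m≥n⇒m⊓n≡n b≤a) lo) ⟩
  a ∸ b     ≡⟨ m≤n⇒∣n-m∣≡n∸m b≤a ⟨
  ∣ a - b ∣ ∎
  where open ≤-Reasoning

between-injective : ∀ {a b p q} → Between a b p → Between a b q → ∣ p - a ∣ ≡ ∣ q - a ∣ → p ≡ q
between-injective {a} {b} {p} {q} (lo , hi) (lo′ , hi′) eq with ≤-total a b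
... | inj₁ a≤b = ∸-cancelʳ-≡ a≤p a≤q
    (trans (sym (m≤n⇒∣n-m∣≡n∸m a≤p)) (trans eq (m≤n⇒∣n-m∣≡n∸m a≤q)))
  where
  a≤p = subst (_≤ p) (m≤n⇒m⊓n≡m a≤b) lo
  a≤q = subst (_≤ q) (m≤n⇒m⊓n≡m a≤b) lo′
... | inj₂ b≤a = ∸-cancelˡ-≡ p≤a q≤a
    (trans (sym (m≤n⇒∣m-n∣≡n∸m p≤a)) (trans eq (m≤n⇒∣m-n∣≡n∸m q≤a)))
  where
  p≤a = subst (p ≤_) (m≥n⇒m⊔n≡m b≤a) hi
  q≤a = subst (q ≤_) (m≥n⇒m⊔n≡m b≤a) hi′

∣1+m-n∣ : ∀ m n → ∣ suc m - n ∣ ≡ suc ∣ m - n ∣ ⊎ ∣ m - n ∣ ≡ suc ∣ suc m - n ∣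
∣1+m-n∣ zero    zero    = inj₁ refl
∣1+m-n∣ (suc m) zero    = inj₁ refl
∣1+m-n∣ zero    (suc n) = inj₂ refl
∣1+m-n∣ (suc m) (suc n) = ∣1+m-n∣ m n

∣m-n∣≡1 : ∀ m n → ∣ m - n ∣ ≡ 1 → m ≡ suc n ⊎ n ≡ suc m
∣m-n∣≡1 zero    n       eq = inj₂ eq
∣m-n∣≡1 (suc m) zero    eq = inj₁ eq
∣m-n∣≡1 (suc m) (suc n) eq with ∣m-n∣≡1 m n eq
... | inj₁ eq′ = inj₁ (cong suc eq′)
... | inj₂ eq′ = inj₂ (cong suc eq′)

m+n≡1 : ∀ m {n} → m + n ≡ 1 → (m ≡ 1 × n ≡ 0) ⊎ (m ≡ 0 × n ≡ 1)
m+n≡1 zero          eq = inj₂ (refl , eq)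
m+n≡1 (suc zero)    eq = inj₁ (refl , suc-injective eq)

module _ (E : ℕ → ℕ) where

  -- The number of cells of the path in the rows below; `index` is then the position along the path,
  -- counted from the tail.
  rowStart : ℕ → ℕ
  rowStart zero    = 0
  rowStart (suc r) = rowStart r + suc ∣ E r - E (1 + r) ∣

  index : ℕ → ℕ → ℕ
  index p r = rowStart r + ∣ p - E r ∣

  rowStart-mono : ∀ {r s} → r ≤′ s → rowStart r ≤ rowStart s
  rowStart-mono ≤′-refl       = ≤-refl
  rowStart-mono (≤′-step r≤s) = ≤-trans (rowStart-mono r≤s) (m≤m+n _ _)

  index-< : ∀ {p r s} q → Between (E r) (E (1 + r)) p → r < s → index p r < index q s
  index-< {p} {r} {s} q b r<s = begin-strict
    rowStart r + ∣ p - E r ∣ <⟨ +-monoʳ-< (rowStart r) (s≤s (between-∣-∣ b)) ⟩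
    rowStart (suc r)         ≤⟨ rowStart-mono (≤⇒≤′ r<s) ⟩
    rowStart s               ≤⟨ m≤m+n (rowStart s) _ ⟩
    index q s                ∎
    where open ≤-Reasoning

  index-injective : ∀ {p q r s} → Between (E r) (E (1 + r)) p → Between (E s) (E (1 + s)) q →
                    index p r ≡ index q s → p ≡ q × r ≡ s
  index-injective {p} {q} {r} {s} b b′ eq with <-cmp r s
  ... | tri< r<s _ _    = contradiction eq (<⇒≢ (index-< q b r<s))
  ... | tri> _ _ s<r    = contradiction (sym eq) (<⇒≢ (index-< p b′ s<r))
  ... | tri≈ _ refl _   = between-injective b b′ (+-cancelˡ-≡ (rowStart r) _ _ eq) , refl

  index-horizontal : ∀ p r → index (suc p) r ≡ suc (index p r) ⊎ index p r ≡ suc (index (suc p) r)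
  index-horizontal p r with ∣1+m-n∣ p (E r)
  ... | inj₁ eq = inj₁ (trans (cong (_+_ (rowStart r)) eq) (+-suc (rowStart r) _))
  ... | inj₂ eq = inj₂ (trans (cong (_+_ (rowStart r)) eq) (+-suc (rowStart r) _))

  module _ (E-smooth : Smooth E) where
    open Smooth E-smooth

    -- The path passes from one row to the next only at the turning depth. A common depth on either
    -- side of it would force both outer turning depths to that same side, making `E (1 + r)` a
    -- strict peak or dip.
    vertical⇒turn : ∀ {p r} → Between (E r) (E (1 + r)) p → Between (E (1 + r)) (E (2 + r)) p → p ≡ E (1 + r)
    vertical⇒turn {p} {r} (lo , hi) (lo′ , hi′) with <-cmp p (E (1 + r))
    ... | tri≈ _ eq _ = eq
    ... | tri< p<e _ _ = contradiction (≤-<-trans e₂≤p p<e) (noPeak r (≤-<-trans e₀≤p p<e))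
      where
      e₀≤p : E r ≤ p
      e₀≤p with ⊓-sel (E r) (E (1 + r))
      ... | inj₁ eq = subst (_≤ p) eq lo
      ... | inj₂ eq = contradiction (subst (_≤ p) eq lo) (<⇒≱ p<e)
      e₂≤p : E (2 + r) ≤ p
      e₂≤p with ⊓-sel (E (1 + r)) (E (2 + r))
      ... | inj₁ eq = contradiction (subst (_≤ p) eq lo′) (<⇒≱ p<e)
      ... | inj₂ eq = subst (_≤ p) eq lo′
    ... | tri> _ _ e<p = contradiction (<-≤-trans e<p p≤e₂) (noDip r (<-≤-trans e<p p≤e₀))
      where
      p≤e₀ : p ≤ E r
      p≤e₀ with ⊔-sel (E r) (E (1 + r))
      ... | inj₁ eq = subst (p ≤_) eq hi
      ... | inj₂ eq = contradiction (subst (p ≤_) eq hi) (<⇒≱ e<p)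
      p≤e₂ : p ≤ E (2 + r)
      p≤e₂ with ⊔-sel (E (1 + r)) (E (2 + r))
      ... | inj₁ eq = contradiction (subst (p ≤_) eq hi′) (<⇒≱ e<p)
      ... | inj₂ eq = subst (p ≤_) eq hi′

    index-vertical : ∀ {p r} → Between (E r) (E (1 + r)) p → Between (E (1 + r)) (E (2 + r)) p →
                     index p (suc r) ≡ suc (index p r)
    index-vertical {p} {r} b b′ with refl ← vertical⇒turn b b′ = begin
      rowStart r + suc ∣ E r - E (1 + r) ∣ + ∣ E (1 + r) - E (1 + r) ∣ ≡⟨ cong (_+_ (rowStart (suc r))) (∣n-n∣≡0 (E (1 + r))) ⟩
      rowStart r + suc ∣ E r - E (1 + r) ∣ + 0                         ≡⟨ +-identityʳ _ ⟩
      rowStart r + suc ∣ E r - E (1 + r) ∣                             ≡⟨ +-suc (rowStart r) _ ⟩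
      suc (rowStart r + ∣ E r - E (1 + r) ∣)                           ≡⟨ cong (λ k → suc (rowStart r + k)) (∣-∣-comm (E r) (E (1 + r))) ⟩
      suc (rowStart r + ∣ E (1 + r) - E r ∣)                           ∎
      where open ≡-Reasoning

    index-adjacent : ∀ {p q r s} → Between (E r) (E (1 + r)) p → Between (E s) (E (1 + s)) q →
                     ∣ p - q ∣ + ∣ r - s ∣ ≡ 1 →
                     index q s ≡ suc (index p r) ⊎ index p r ≡ suc (index q s)
    index-adjacent {p} {q} {r} {s} b b′ adj with m+n≡1 ∣ p - q ∣ adj
    ... | inj₁ (pq , rs) with refl ← ∣m-n∣≡0⇒m≡n {r} {s} rs with ∣m-n∣≡1 p q pq
    ...   | inj₂ refl = index-horizontal p r
    ...   | inj₁ refl with index-horizontal q r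
    ...     | inj₁ eq = inj₂ eq
    ...     | inj₂ eq = inj₁ eq
    index-adjacent {p} {q} {r} {s} b b′ adj | inj₂ (pq , rs) with refl ← ∣m-n∣≡0⇒m≡n {p} {q} pq with ∣m-n∣≡1 r s rs
    ...   | inj₁ refl = inj₂ (index-vertical b′ b)
    ...   | inj₂ refl = inj₁ (index-vertical b b′)

-- Coordinates relative to an origin

-- Depths are measured westwards from the column of the tail.
at : Cell → ℕ → ℕ → Cell
at o p r = column o ℤ.- + p , row o ℤ.+ + r

∣m⊖n∣≡∣m-n∣ : ∀ m n → ∣ m ⊖ n ∣ ≡ ℕ.∣ m - n ∣
∣m⊖n∣≡∣m-n∣ zero    zero    = refl
∣m⊖n∣≡∣m-n∣ zero    (suc n) = refl
∣m⊖n∣≡∣m-n∣ (suc m) zero    = refl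
∣m⊖n∣≡∣m-n∣ (suc m) (suc n) = trans (cong ∣_∣ (ℤₚ.[1+m]⊖[1+n]≡m⊖n m n)) (∣m⊖n∣≡∣m-n∣ m n)

∣m-n∣-cast : ∀ m n → ∣ + m ℤ.- + n ∣ ≡ ℕ.∣ m - n ∣
∣m-n∣-cast m n = trans (cong ∣_∣ (ℤₚ.m-n≡m⊖n m n)) (∣m⊖n∣≡∣m-n∣ m n)

column-distance : ∀ a p q → ∣ (a ℤ.- + p) ℤ.- (a ℤ.- + q) ∣ ≡ ℕ.∣ p - q ∣
column-distance a p q = trans (cong ∣_∣ (cancel a (+ p) (+ q)))
                              (trans (∣m-n∣-cast q p) (∣-∣-comm q p))
  where
  cancel : ∀ a p q → (a ℤ.- p) ℤ.- (a ℤ.- q) ≡ q ℤ.- p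
  cancel = solve-∀

row-distance : ∀ b r s → ∣ (b ℤ.+ + r) ℤ.- (b ℤ.+ + s) ∣ ≡ ℕ.∣ r - s ∣
row-distance b r s = trans (cong ∣_∣ (cancel b (+ r) (+ s))) (∣m-n∣-cast r s)
  where
  cancel : ∀ b r s → (b ℤ.+ r) ℤ.- (b ℤ.+ s) ≡ r ℤ.- s
  cancel = solve-∀

depth height : Cell → Cell → ℕ
depth  o c = ∣ column o ℤ.- column c ∣
height o c = ∣ row c ℤ.- row o ∣

depth-at : ∀ o p r → depth o (at o p r) ≡ p
depth-at (a , _) p r = cong ∣_∣ (cancel a (+ p))
  where
  cancel : ∀ a p → a ℤ.- (a ℤ.- p) ≡ p
  cancel = solve-∀

height-at : ∀ o p r → height o (at o p r) ≡ r
height-at (_ , b) p r = cong ∣_∣ (cancel b (+ r))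
  where
  cancel : ∀ b r → (b ℤ.+ r) ℤ.- b ≡ r
  cancel = solve-∀

at-injective : ∀ o {p q r s} → at o p r ≡ at o q s → p ≡ q × r ≡ s
at-injective o {p} {q} {r} {s} eq =
  trans (sym (depth-at o p r)) (trans (cong (depth o) eq) (depth-at o q s)) ,
  trans (sym (height-at o p r)) (trans (cong (height o) eq) (height-at o q s))

adjacent-at⁻ : ∀ o {p q r s} → Adjacent (at o p r) (at o q s) → ℕ.∣ p - q ∣ + ℕ.∣ r - s ∣ ≡ 1
adjacent-at⁻ o {p} {q} {r} {s} =
  trans (sym (cong₂ _+_ (column-distance (column o) p q) (row-distance (row o) r s)))

at-column-≤ : ∀ o p r → column (at o p r) ℤ.≤ column o
at-column-≤ o p r = ℤₚ.i-j≤i (column o) (+ p)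

at-origin : ∀ o → at o 0 0 ≡ o
at-origin (a , b) = cong₂ _,_ (ℤₚ.+-identityʳ a) (ℤₚ.+-identityʳ b)

at-complete : ∀ o c → column c ℤ.≤ column o → row o ℤ.≤ row c → c ≡ at o (depth o c) (height o c)
at-complete o@(a , b) (x , y) x≤a b≤y = cong₂ _,_
  (trans (left a x) (cong (λ k → a ℤ.- k) (sym (ℤₚ.0≤i⇒+∣i∣≡i (ℤₚ.i≤j⇒0≤j-i x≤a)))))
  (trans (right b y) (cong (λ k → b ℤ.+ k) (sym (ℤₚ.0≤i⇒+∣i∣≡i (ℤₚ.i≤j⇒0≤j-i b≤y)))))
  where
  left : ∀ a x → x ≡ a ℤ.- (a ℤ.- x)
  left = solve-∀
  right : ∀ b y → y ≡ b ℤ.+ (y ℤ.- b)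
  right = solve-∀

at-north : ∀ o p r → at o p r ⊕ (0ℤ , 1ℤ) ≡ at o p (suc r)
at-north (a , b) p r = cong₂ _,_ (ℤₚ.+-identityʳ _) (shift b (+ r))
  where
  shift : ∀ b r → b ℤ.+ r ℤ.+ 1ℤ ≡ b ℤ.+ (1ℤ ℤ.+ r)
  shift = solve-∀

at-east : ∀ o p r → at o (suc p) r ⊕ (1ℤ , 0ℤ) ≡ at o p r
at-east (a , b) p r = cong₂ _,_ (shift a (+ p)) (ℤₚ.+-identityʳ _)
  where
  shift : ∀ a p → a ℤ.- (1ℤ ℤ.+ p) ℤ.+ 1ℤ ≡ a ℤ.- p
  shift = solve-∀

at-west : ∀ o p r → at o p r ⊕ (-1ℤ , 0ℤ) ≡ at o (suc p) r
at-west (a , b) p r = cong₂ _,_ (shift a (+ p)) (ℤₚ.+-identityʳ _)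
  where
  shift : ∀ a p → a ℤ.- p ℤ.+ -1ℤ ≡ a ℤ.- (1ℤ ℤ.+ p)
  shift = solve-∀

step-north : ∀ o p r → Step (at o p r) (at o p (suc r))
step-north o p r = inj₁ (sym (at-north o p r))

step-east : ∀ o p r → Step (at o (suc p) r) (at o p r)
step-east o p r = inj₂ (inj₁ (sym (at-east o p r)))

step-west : ∀ o p r → Step (at o p r) (at o (suc p) r)
step-west o p r = inj₂ (inj₂ (sym (at-west o p r)))

-- The starting depth `x` and row `k` are arbitrary so that induction along a path can move them.
-- Prepending `x` makes the depth of leaving one row the depth of entering the next.
PathCells : Cell → ℕ → List ℕ → ℕ → CellSet
PathCells o x ds k c =
  ∃[ p ] ∃[ i ] c ≡ at o p (k + i) × OnPath (rowAt (x ∷ ds)) (length ds) p i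

module _ {o : Cell} {P : CellSet} {E : ℕ → ℕ} {n : ℕ}
         (P≐ : P ≐ (λ c → ∃[ p ] ∃[ r ] c ≡ at o p r × OnPath E n p r)) (E-smooth : Smooth E) where

  private
    ρ : Cell → ℕ
    ρ c = index E (depth o c) (height o c)

    ρ-at : ∀ p r → ρ (at o p r) ≡ index E p r
    ρ-at p r = cong₂ (index E) (depth-at o p r) (height-at o p r)

    ρ-injective : ∀ {c d} → P c → P d → ρ c ≡ ρ d → c ≡ d
    ρ-injective c∈ d∈ eq with proj₁ P≐ c∈ | proj₁ P≐ d∈
    ... | p , r , refl , _ , b | q , s , refl , _ , b′ with index-injective E b b′ (trans (sym (ρ-at p r)) (trans eq (ρ-at q s)))
    ...   | refl , refl = refl

    ρ-adjacent : ∀ {c d} → AdjacentIn P c d → ρ d ≡ suc (ρ c) ⊎ ρ c ≡ suc (ρ d)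
    ρ-adjacent (c∈ , d∈ , adj) with proj₁ P≐ c∈ | proj₁ P≐ d∈
    ... | p , r , refl , _ , b | q , s , refl , _ , b′ rewrite ρ-at p r | ρ-at q s =
      index-adjacent E E-smooth b b′ (adjacent-at⁻ o {p} {q} {r} {s} adj)

  path⇒snake : ∀ {c cs} → P ≐ (_∈ c ∷ cs) → Linked Step (c ∷ cs) → IsSnake P
  path⇒snake enumerates steps = record
    { finite    = _ , enumerates
    ; connected = linked⇒connected enumerates steps
    ; acyclic   = indexed⇒acyclic ρ ρ-injective ρ-adjacent
    ; degrees   = indexed⇒degrees≤2 ρ ρ-injective ρ-adjacent
    }

-- Paths and their turning depths

module _ (o : Cell) where

  -- A path from depth x in row k, given by the depths ds at which it leaves
  -- the rows k, k + 1, …; the indexed list omits the initial cell.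
  data Trace : ℕ → List ℕ → ℕ → List Cell → Set where
    stop  : ∀ {x k} → Trace x (x ∷ []) k []
    north : ∀ {x ds k cs} → Trace x ds (suc k) cs → Trace x (x ∷ ds) k (at o x (suc k) ∷ cs)
    west  : ∀ {x d ds k cs} → suc x ≤ d → Trace (suc x) (d ∷ ds) k cs →
            Trace x (d ∷ ds) k (at o (suc x) k ∷ cs)
    east  : ∀ {x d ds k cs} → d ≤ x → Trace x (d ∷ ds) k cs →
            Trace (suc x) (d ∷ ds) k (at o x k ∷ cs)

  trace-linked : ∀ {x ds k cs} → Trace x ds k cs → Linked Step (at o x k ∷ cs)
  trace-linked stop        = [-]
  trace-linked (north t)   = step-north o _ _ ∷ trace-linked t
  trace-linked (west _ t)  = step-west o _ _ ∷ trace-linked t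
  trace-linked (east _ t)  = step-east o _ _ ∷ trace-linked t

  trace-last : ∀ {x ds k cs} → Trace x ds k cs → ∃[ j ] suc j ≡ k + length ds ×
               List.last (at o x k ∷ cs) ≡ just (at o (rowAt (x ∷ ds) (length ds)) j)
  trace-last {k = k} stop = k , +-comm 1 k , refl
  trace-last {k = k} (north t) with j , eq , last ← trace-last t = j , trans eq (sym (+-suc k _)) , last
  trace-last (west _ t) = trace-last t
  trace-last (east _ t) = trace-last t

  between-extendˡ : ∀ {x d p} → suc x ≤ d → Between (suc x) d p → Between x d p
  between-extendˡ {x} {d} x<d (lo , hi) =
    ≤-trans (⊓-monoˡ-≤ d (n≤1+n x)) lo ,
    ≤-trans hi (≤-reflexive (trans (m≤n⇒m⊔n≡n x<d) (sym (m≤n⇒m⊔n≡n (<⇒≤ x<d)))))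

  between-extendʳ : ∀ {x d p} → d ≤ x → Between x d p → Between (suc x) d p
  between-extendʳ {x} {d} d≤x (lo , hi) =
    ≤-trans (≤-reflexive (trans (m≥n⇒m⊓n≡n (m≤n⇒m≤1+n d≤x)) (sym (m≥n⇒m⊓n≡n d≤x)))) lo ,
    ≤-trans hi (⊔-monoˡ-≤ d (n≤1+n x))

  between-west : ∀ {x d p} → suc x ≤ d → Between x d p → p ≡ x ⊎ Between (suc x) d p
  between-west {x} {d} {p} x<d (lo , hi) with <-cmp p x
  ... | tri< p<x _ _ = contradiction (subst (_≤ p) (m≤n⇒m⊓n≡m (<⇒≤ x<d)) lo) (<⇒≱ p<x)
  ... | tri≈ _ eq _  = inj₁ eq
  ... | tri> _ _ x<p = inj₂
    ( ≤-trans (m⊓n≤m (suc x) d) x<p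
    , ≤-trans hi (≤-trans (≤-reflexive (m≤n⇒m⊔n≡n (<⇒≤ x<d))) (m≤n⊔m (suc x) d)))

  between-east : ∀ {x d p} → d ≤ x → Between (suc x) d p → p ≡ suc x ⊎ Between x d p
  between-east {x} {d} {p} d≤x (lo , hi) with <-cmp p (suc x)
  ... | tri> _ _ x<p = contradiction (subst (p ≤_) (m≥n⇒m⊔n≡m (m≤n⇒m≤1+n d≤x)) hi) (<⇒≱ x<p)
  ... | tri≈ _ eq _  = inj₁ eq
  ... | tri< (s≤s p≤x) _ _ = inj₂
    ( ≤-trans (m⊓n≤n x d) (≤-trans (≤-reflexive (sym (m≥n⇒m⊓n≡n (m≤n⇒m≤1+n d≤x)))) lo)
    , ≤-trans p≤x (m≤m⊔n x d))

  trace-start : ∀ {x d ds k} → PathCells o x (d ∷ ds) k (at o x k)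
  trace-start {x} {d} {k = k} =
    x , 0 , cong (at o x) (sym (+-identityʳ k)) , z<s , between-left x d

  trace-∈⁻ : ∀ {x ds k cs c} → Trace x ds k cs → c ∈ at o x k ∷ cs → PathCells o x ds k c
  trace-∈⁻ stop       (here refl) = trace-start
  trace-∈⁻ (north _)  (here refl) = trace-start
  trace-∈⁻ (west _ _) (here refl) = trace-start
  trace-∈⁻ (east _ _) (here refl) = trace-start
  trace-∈⁻ {k = k} (north t) (there c∈) with p , i , refl , i<n , b ← trace-∈⁻ t c∈ =
    p , suc i , cong (at o p) (sym (+-suc k i)) , s≤s i<n , b
  trace-∈⁻ (west x<d t) (there c∈) with trace-∈⁻ t c∈
  ... | p , zero  , eq , i<n , b = p , 0 , eq , i<n , between-extendˡ x<d b
  ... | p , suc i , eq , i<n , b = p , suc i , eq , i<n , b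
  trace-∈⁻ (east d≤x t) (there c∈) with trace-∈⁻ t c∈
  ... | p , zero  , eq , i<n , b = p , 0 , eq , i<n , between-extendʳ d≤x b
  ... | p , suc i , eq , i<n , b = p , suc i , eq , i<n , b

  trace-∈⁺ : ∀ {x ds k cs c} → Trace x ds k cs → PathCells o x ds k c → c ∈ at o x k ∷ cs
  trace-∈⁺ {x} {k = k} stop (p , zero , refl , _ , lo , hi) =
    here (cong₂ (at o) (≤-antisym (subst (p ≤_) (⊔-idem x) hi) (subst (_≤ p) (⊓-idem x) lo))
                       (+-identityʳ k))
  trace-∈⁺ stop (p , suc i , _ , s≤s () , _)
  trace-∈⁺ {x} {k = k} (north t) (p , zero , refl , _ , lo , hi) =
    here (cong₂ (at o) (≤-antisym (subst (p ≤_) (⊔-idem x) hi) (subst (_≤ p) (⊓-idem x) lo))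
                       (+-identityʳ k))
  trace-∈⁺ {k = k} (north t) (p , suc i , refl , s≤s i<n , b) =
    there (trace-∈⁺ t (p , i , cong (at o p) (+-suc k i) , i<n , b))
  trace-∈⁺ {k = k} (west x<d t) (p , zero , refl , i<n , b) with between-west x<d b
  ... | inj₁ refl = here (cong (at o p) (+-identityʳ k))
  ... | inj₂ b′   = there (trace-∈⁺ t (p , 0 , refl , i<n , b′))
  trace-∈⁺ (west x<d t) (p , suc i , eq , i<n , b) = there (trace-∈⁺ t (p , suc i , eq , i<n , b))
  trace-∈⁺ {k = k} (east d≤x t) (p , zero , refl , i<n , b) with between-east d≤x b
  ... | inj₁ refl = here (cong (at o p) (+-identityʳ k))
  ... | inj₂ b′   = there (trace-∈⁺ t (p , 0 , refl , i<n , b′))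
  trace-∈⁺ (east d≤x t) (p , suc i , eq , i<n , b) = there (trace-∈⁺ t (p , suc i , eq , i<n , b))

  pathCells-bottomRow : ∀ {x d ds k q} → PathCells o x (d ∷ ds) k (at o q k) → Between x d q
  pathCells-bottomRow {k = k} (p , i , eq , _ , b) with at-injective o eq
  ... | refl , k≡k+i with refl ← +-cancelˡ-≡ k i 0 (trans (sym k≡k+i) (sym (+-identityʳ k))) = b

  -- What follows a step lies in higher rows, or in the same row strictly beyond the current depth
  -- in the direction of the step.
  trace-unique : ∀ {x ds k cs} → Trace x ds k cs → Unique (at o x k ∷ cs)
  trace-unique stop = [] ∷ []
  trace-unique {x} {k = k} (north t) = ¬Any⇒All¬ _ fresh ∷ trace-unique t
    where
    fresh : ¬ at o x k ∈ _
    fresh c∈ with _ , i , eq , _ ← trace-∈⁻ t c∈ = m≢1+m+n k (proj₂ (at-injective o eq))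
  trace-unique {x} {d ∷ _} {k} (west x<d t) = ¬Any⇒All¬ _ fresh ∷ trace-unique t
    where
    fresh : ¬ at o x k ∈ _
    fresh c∈ = <⇒≱ ≤-refl (subst (_≤ x) (m≤n⇒m⊓n≡m x<d) (proj₁ (pathCells-bottomRow (trace-∈⁻ t c∈))))
  trace-unique {suc x} {d ∷ _} {k} (east d≤x t) = ¬Any⇒All¬ _ fresh ∷ trace-unique t
    where
    fresh : ¬ at o (suc x) k ∈ _
    fresh c∈ = <⇒≱ ≤-refl (subst (suc x ≤_) (m≥n⇒m⊔n≡m d≤x) (proj₂ (pathCells-bottomRow (trace-∈⁻ t c∈))))

  climb : ∀ m {x d ds k} → m + x ≡ d → ∃ (Trace d (d ∷ ds) k) → ∃ (Trace x (d ∷ ds) k)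
  climb zero    refl t = t
  climb (suc m) {x} refl t with cs , t′ ← climb m (+-suc m x) t =
    _ , west (s≤s (m≤n+m x m)) t′

  descend : ∀ m {x d ds k} → m + d ≡ x → ∃ (Trace d (d ∷ ds) k) → ∃ (Trace x (d ∷ ds) k)
  descend zero    refl t = t
  descend (suc m) {d = d} refl t with cs , t′ ← descend m refl t = _ , east (m≤n+m d m) t′

  ∃-trace : ∀ x d ds k → ∃ (Trace x (d ∷ ds) k)
  ∃-trace-turn : ∀ d ds k → ∃ (Trace d (d ∷ ds) k)

  ∃-trace x d ds k with ≤-total x d
  ... | inj₁ x≤d = climb (d ∸ x) (m∸n+n≡m x≤d) (∃-trace-turn d ds k)
  ... | inj₂ d≤x = descend (x ∸ d) (m∸n+n≡m d≤x) (∃-trace-turn d ds k)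

  ∃-trace-turn d []       k = _ , stop
  ∃-trace-turn d (e ∷ ds) k = _ , north (proj₂ (∃-trace d e ds (suc k)))

  -- The rest of the path is parsed before the current step is accepted: it fills its bottom row up
  -- to the depth `d` at which it leaves. If a horizontal step led away from `d`, the starting cell
  -- would be visited again.
  parse : ∀ {x k c} cs → c ≡ at o x k → Linked Step (c ∷ cs) → Unique (c ∷ cs) →
          All (λ c → column c ℤ.≤ column o) cs → ∃[ d ] ∃[ ds ] Trace x (d ∷ ds) k cs
  parse {x} [] _ _ _ _ = x , [] , stop
  parse {x} {k} (c′ ∷ cs) refl (inj₁ s ∷ l) (_ ∷ u) (_ ∷ a)
    with refl ← trans s (at-north o x k)
    with d , ds , t ← parse cs refl l u a = x , d ∷ ds , north t
  parse {x} {k} (c′ ∷ cs) refl (inj₂ (inj₂ s) ∷ l) (x∉ ∷ u) (_ ∷ a)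
    with refl ← trans s (at-west o x k)
    with d , ds , t ← parse cs refl l u a
    with suc x ≤? d
  ... | yes x<d = d , ds , west x<d t
  ... | no  x≮d = contradiction
    (trace-∈⁺ t (x , 0 , cong (at o x) (sym (+-identityʳ k)) , z<s ,
      ≤-trans (m⊓n≤n (suc x) d) (≮⇒≥ x≮d) , ≤-trans (n≤1+n x) (m≤m⊔n (suc x) d)))
    (All¬⇒¬Any x∉)
  -- Stepping East at depth 0 would leave the half-plane in which depths are natural numbers.
  parse {zero} {k} (c′ ∷ cs) refl (inj₂ (inj₁ s) ∷ l) (x∉ ∷ u) (c′≤o ∷ a) =
    contradiction (subst (ℤ._≤ column o) (trans (cong column s) (shift (column o))) c′≤o)
                  (ℤₚ.<⇒≱ (ℤₚ.suc[i]≤j⇒i<j ℤₚ.≤-refl))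
    where
    shift : ∀ i → i ℤ.- 0ℤ ℤ.+ 1ℤ ≡ 1ℤ ℤ.+ i
    shift = solve-∀
  parse {suc x} {k} (c′ ∷ cs) refl (inj₂ (inj₁ s) ∷ l) (x∉ ∷ u) (_ ∷ a)
    with refl ← trans s (at-east o x k)
    with d , ds , t ← parse cs refl l u a
    with d ≤? x
  ... | yes d≤x = d , ds , east d≤x t
  ... | no  d≰x = contradiction
    (trace-∈⁺ t (suc x , 0 , cong (at o (suc x)) (sym (+-identityʳ k)) , z<s ,
      ≤-trans (m⊓n≤m x d) (n≤1+n x) , ≤-trans (≰⇒> d≰x) (m≤n⊔m x d)))
    (All¬⇒¬Any x∉)

-- Envelopes as paths

rowAt-lookup : ∀ as i → rowAt as (toℕ i) ≡ lookup as i
rowAt-lookup (a ∷ as) zero    = refl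
rowAt-lookup (a ∷ as) (suc i) = rowAt-lookup as i

rowAt-outside : ∀ {as i} → length as ≤ i → rowAt as i ≡ 0
rowAt-outside {[]}             _         = refl
rowAt-outside {a ∷ as} {suc i} (s≤s len) = rowAt-outside {as} len

rowAt-inside : ∀ {as i} → 0 < rowAt as i → i < length as
rowAt-inside {as} {i} pos = ≰⇒> λ len → <⇒≢ pos (sym (rowAt-outside {as} len))

rowAt-positive : ∀ {as i} → All (1 ≤_) as → i < length as → 0 < rowAt as i
rowAt-positive {i = zero}  (pos ∷ _) _         = pos
rowAt-positive {i = suc i} (_ ∷ pos) (s≤s i<n) = rowAt-positive pos i<n

rowAt-applyUpTo : ∀ f n → (∀ i → n ≤ i → f i ≡ 0) → ∀ i → rowAt (applyUpTo f n) i ≡ f i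
rowAt-applyUpTo f zero    f≡0 i       = sym (f≡0 i z≤n)
rowAt-applyUpTo f (suc n) f≡0 zero    = refl
rowAt-applyUpTo f (suc n) f≡0 (suc i) = rowAt-applyUpTo (f ∘ suc) n (λ i → f≡0 (suc i) ∘ s≤s) i

-- The tail of every envelope.
envelopeOrigin : Cell
envelopeOrigin = 0ℤ , -1ℤ

-- Heights are counted from `envelopeOrigin`, one row below the bargraph; hence the single 0 in
-- front.
cellsOf⁻ : ∀ as p r → cellsOf as (at envelopeOrigin p r) → p < rowAt (0 ∷ toList as) r
cellsOf⁻ as p (suc r) (i , refl , l , _) =
  subst (p <_) (sym (rowAt-lookup (toList as) i))
    (ℤₚ.drop‿+<+ (ℤₚ.neg-cancel-< (subst (- (+ lookup (toList as) i) ℤ.<_) (ℤₚ.+-identityˡ (- (+ p))) l)))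

cellsOf⁺ : ∀ as p r → p < rowAt (0 ∷ toList as) r → cellsOf as (at envelopeOrigin p r)
cellsOf⁺ as p (suc r) l = i , cong +_ (sym (toℕ-fromℕ< r<n)) ,
  subst (- (+ lookup (toList as) i) ℤ.<_) (sym (ℤₚ.+-identityˡ (- (+ p))))
    (ℤₚ.neg-mono-< (ℤ.+<+ (subst (p <_) (trans (cong (rowAt (toList as)) (sym (toℕ-fromℕ< r<n)))
                                               (rowAt-lookup (toList as) i)) l))) ,
  at-column-≤ envelopeOrigin p (suc r)
  where
  r<n = rowAt-inside {toList as} (≤-<-trans z≤n l)
  i   = fromℕ< r<n

cellsOf-at : ∀ {as c} → cellsOf as c → ∃[ q ] ∃[ s ] c ≡ at envelopeOrigin q s
cellsOf-at {c = c@(x , y)} (i , refl , _ , x≤0) =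
  depth envelopeOrigin c , height envelopeOrigin c , at-complete envelopeOrigin c x≤0 ℤ.-≤+

-- Contact with a row of index at least 0 keeps a cell in row -1 or higher, so both of its relative
-- coordinates are natural numbers.
envelope-at : ∀ {as c} → envelope as c → c ≡ at envelopeOrigin (depth envelopeOrigin c) (height envelopeOrigin c)
envelope-at {c = x , y} (_ , ((x′ , y′) , (i , refl , _) , contact) , x≤0) =
  at-complete envelopeOrigin (x , y) x≤0
    (row≥-1 y (toℕ i) (≤-trans (m≤n⊔m ℤ.∣ x ℤ.- x′ ∣ _) (≤-reflexive contact)))
  where
  row≥-1 : ∀ y n → ℤ.∣ y ℤ.- + n ∣ ≤ 1 → -1ℤ ℤ.≤ y
  row≥-1 (+ _)          n       _        = ℤ.-≤+
  row≥-1 -[1+ zero ]    n       _        = ℤ.-≤- z≤n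
  row≥-1 -[1+ suc k ]   zero    (s≤s ())
  row≥-1 -[1+ suc k ]   (suc n) (s≤s ())

contact-at : ∀ o p q r s → Contact (at o p r) (at o q s) ≡ (ℕ.∣ p - q ∣ ⊔ ℕ.∣ r - s ∣ ≡ 1)
contact-at o p q r s =
  cong (_≡ 1) (cong₂ _⊔_ (column-distance (column o) p q) (row-distance (row o) r s))

-- The first 0 makes the formula for the depth at which the path enters a row
-- valid also at the tail, the second 0 is the row of the tail itself.
paddedRow : List ℕ → ℕ → ℕ
paddedRow as = rowAt (0 ∷ 0 ∷ as)

-- For a padded sequence C of row lengths, the bargraph has C (1 + r) cells at
-- height r above the tail.
Surrounds : (ℕ → ℕ) → ℕ → ℕ → Set
Surrounds C p r = C (1 + r) ≤ p × ∃[ s ] ℕ.∣ r - s ∣ ≤ 1 × 0 < C (1 + s) × p ≤ C (1 + s)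

envelope⁻ : ∀ as p r → envelope as (at envelopeOrigin p r) → Surrounds (paddedRow (toList as)) p r
envelope⁻ as p r (c∉ , (d , d∈ , contact) , _) with q , s , refl ← cellsOf-at d∈ =
  ≮⇒≥ (c∉ ∘ cellsOf⁺ as p r) , s ,
  ≤-trans (m≤n⊔m ℕ.∣ p - q ∣ _) (≤-reflexive contact′) ,
  ≤-<-trans z≤n q<C ,
  ≤-trans (m≤n+∣m-n∣ p q) (≤-trans (+-monoʳ-≤ q (≤-trans (m≤m⊔n _ ℕ.∣ r - s ∣) (≤-reflexive contact′)))
                                   (≤-trans (≤-reflexive (+-comm q 1)) q<C))
  where
  contact′ = subst id (contact-at envelopeOrigin p q r s) contact
  q<C = cellsOf⁻ as q s d∈

envelope⁺ : ∀ as p r → Surrounds (paddedRow (toList as)) p r → envelope as (at envelopeOrigin p r)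
envelope⁺ as p r (C≤p , s , near , pos , p≤C) =
  (λ c∈ → <⇒≱ (cellsOf⁻ as p r c∈) C≤p) , neighbour , at-column-≤ envelopeOrigin p r
  where
  C = paddedRow (toList as)

  touching : ∀ q → q < C (1 + s) → ℕ.∣ p - q ∣ ⊔ ℕ.∣ r - s ∣ ≡ 1 →
             ∃[ d ] cellsOf as d × Contact (at envelopeOrigin p r) d
  touching q q<C eq = at envelopeOrigin q s , cellsOf⁺ as q s q<C , subst id (sym (contact-at envelopeOrigin p q r s)) eq

  neighbour : ∃[ d ] cellsOf as d × Contact (at envelopeOrigin p r) d
  neighbour with m≤n⇒m<n∨m≡n p≤C
  -- Depth `p` is outside row `r` but inside row `s`, so the rows differ and the cell of row `s` in
  -- the same column is a side contact.
  ... | inj₁ p<C = touching p p<C (trans (cong (_⊔ ℕ.∣ r - s ∣) (∣n-n∣≡0 p))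
                     (≤-antisym near (n≢0⇒n>0 λ eq → <⇒≱ p<C (subst (λ k → C (1 + k) ≤ p) (∣m-n∣≡0⇒m≡n {r} {s} eq) C≤p))))
  -- The depth is that just West of row `s`, so the leftmost cell of that row is touched: by a side
  -- if `s` is `r`, by a corner otherwise.
  ... | inj₂ refl = touching (pred p) (≤-reflexive (suc-pred p {{>-nonZero pos}}))
                     (trans (cong (_⊔ ℕ.∣ r - s ∣) (∣p-pred[p]∣ p pos)) (m≥n⇒m⊔n≡m near))
    where
    ∣p-pred[p]∣ : ∀ p → 0 < p → ℕ.∣ p - pred p ∣ ≡ 1
    ∣p-pred[p]∣ (suc p) _ = trans (m≤n⇒∣n-m∣≡n∸m (n≤1+n p)) (m+n∸n≡m 1 p)

∣n-1+n∣≤1 : ∀ n → ℕ.∣ n - suc n ∣ ≤ 1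
∣n-1+n∣≤1 zero    = ≤-refl
∣n-1+n∣≤1 (suc n) = ∣n-1+n∣≤1 n

⊔-sel₃ : ∀ a b c → let m = (a ⊔ b) ⊔ (b ⊔ c) in m ≡ a ⊎ m ≡ b ⊎ m ≡ c
⊔-sel₃ a b c with ⊔-sel (a ⊔ b) (b ⊔ c)
⊔-sel₃ a b c | inj₁ eq with ⊔-sel a b
... | inj₁ eq′ = inj₁ (trans eq eq′)
... | inj₂ eq′ = inj₂ (inj₁ (trans eq eq′))
⊔-sel₃ a b c | inj₂ eq with ⊔-sel b c
... | inj₁ eq′ = inj₂ (inj₁ (trans eq eq′))
... | inj₂ eq′ = inj₂ (inj₂ (trans eq eq′))

module _ (as : List ℕ) (nonempty : 1 ≤ length as) (positive : All (1 ≤_) as)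
         (C-ok : NoShortWell (paddedRow as)) where

  private
    C = paddedRow as
    m = length as

  -- The path occupies the rows of the bargraph, one row below and one above: `2 + m` rows, each
  -- with the depth at which it is left.
  turns : List ℕ
  turns = applyUpTo (λ i → C (1 + i) ⊔ C (2 + i)) (2 + m)

  private
    E = rowAt (0 ∷ turns)

  turns-⊔ : ∀ i → E i ≡ C i ⊔ C (1 + i)
  turns-⊔ zero    = refl
  turns-⊔ (suc i) = rowAt-applyUpTo _ (2 + m) vanish i
    where
    vanish : ∀ i → 2 + m ≤ i → C (1 + i) ⊔ C (2 + i) ≡ 0
    vanish (suc (suc i)) (s≤s (s≤s len)) =
      cong₂ _⊔_ (rowAt-outside {as} (m≤n⇒m≤1+n len)) (rowAt-outside {as} (m≤n⇒m≤1+n (m≤n⇒m≤1+n len)))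

  turns-smooth : Smooth E
  turns-smooth = ⊔-smooth turns-⊔ C-ok

  private
    C-positive : ∀ {i} → i < m → 0 < C (2 + i)
    C-positive = rowAt-positive positive

    C-inside : ∀ {s} → 0 < C (1 + s) → s ≤ m
    C-inside {suc s} pos = rowAt-inside {as} pos

    top≡ : ∀ r → E r ⊔ E (1 + r) ≡ (C r ⊔ C (1 + r)) ⊔ (C (1 + r) ⊔ C (2 + r))
    top≡ r = cong₂ _⊔_ (turns-⊔ r) (turns-⊔ (1 + r))

    C₀≤top : ∀ r → C r ≤ E r ⊔ E (1 + r)
    C₀≤top r = ≤-trans (≤-trans (m≤m⊔n (C r) _) (m≤m⊔n _ _)) (≤-reflexive (sym (top≡ r)))

    C₁≤top : ∀ r → C (1 + r) ≤ E r ⊔ E (1 + r)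
    C₁≤top r = ≤-trans (≤-trans (m≤n⊔m (C r) _) (m≤m⊔n _ _)) (≤-reflexive (sym (top≡ r)))

    C₂≤top : ∀ r → C (2 + r) ≤ E r ⊔ E (1 + r)
    C₂≤top r = ≤-trans (≤-trans (m≤n⊔m (C (1 + r)) _) (m≤n⊔m (C r ⊔ C (1 + r)) _)) (≤-reflexive (sym (top≡ r)))

    -- Each row of the path is level with or next to a nonempty row: the one above it if `r < m`,
    -- and the topmost row of the bargraph for the last two.
    top-positive : ∀ {r} → r < 2 + m → 0 < E r ⊔ E (1 + r)
    top-positive {r} r<n with r <? m
    ... | yes r<m = <-≤-trans (C-positive r<m) (C₂≤top r)
    ... | no  r≮m with m≤n⇒m<n∨m≡n (≮⇒≥ r≮m)
    ...   | inj₂ refl = <-≤-trans (subst (λ k → 0 < C (1 + k)) (suc-pred m {{>-nonZero nonempty}})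
                                         (C-positive (≤-reflexive (suc-pred m {{>-nonZero nonempty}}))))
                                  (C₁≤top r)
    ...   | inj₁ m<r with refl ← ≤-antisym (≤-pred r<n) m<r =
        <-≤-trans (subst (λ k → 0 < C (1 + k)) (suc-pred m {{>-nonZero nonempty}})
                         (C-positive (≤-reflexive (suc-pred m {{>-nonZero nonempty}}))))
                  (C₀≤top r)

  -- In each row of the path both sets are the same interval of depths, from `C (1 + r)` (by
  -- `⊓-of-⊔`) to the greatest of the rows at heights `r − 1`, `r` and `r + 1`.
  surrounds⇒onPath : ∀ {p r} → Surrounds C p r → OnPath E (2 + m) p r
  surrounds⇒onPath {p} {r} (C≤p , s , near , pos , p≤C) =
    s≤s (≤-trans r≤1+s (s≤s (C-inside pos))) ,
    ≤-trans (≤-reflexive (⊓-of-⊔ turns-⊔ C-ok r)) C≤p ,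
    ≤-trans p≤C C≤top
    where
    r≤1+s : r ≤ suc s
    r≤1+s = ≤-trans (m≤n+∣m-n∣ r s) (≤-trans (+-monoʳ-≤ s near) (≤-reflexive (+-comm s 1)))
    s≤1+r : s ≤ suc r
    s≤1+r = ≤-trans (m≤n+∣n-m∣ s r) (≤-trans (+-monoʳ-≤ r near) (≤-reflexive (+-comm r 1)))
    C≤top : C (1 + s) ≤ E r ⊔ E (1 + r)
    C≤top with <-cmp r s
    ... | tri≈ _ refl _ = C₁≤top r
    ... | tri< r<s _ _ with refl ← ≤-antisym s≤1+r r<s = C₂≤top r
    ... | tri> _ _ s<r with refl ← ≤-antisym r≤1+s s<r = C₀≤top r

  onPath⇒surrounds : ∀ {p r} → OnPath E (2 + m) p r → Surrounds C p r
  onPath⇒surrounds {p} {r} (r<n , lo , hi) =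
    ≤-trans (≤-reflexive (sym (⊓-of-⊔ turns-⊔ C-ok r))) lo , highest r hi (top-positive r<n) (⊔-sel₃ (C r) (C (1 + r)) (C (2 + r)))
    where
    highest : ∀ r → p ≤ E r ⊔ E (1 + r) → 0 < E r ⊔ E (1 + r) →
              (let t = (C r ⊔ C (1 + r)) ⊔ (C (1 + r) ⊔ C (2 + r)) in t ≡ C r ⊎ t ≡ C (1 + r) ⊎ t ≡ C (2 + r)) →
              ∃[ s ] ℕ.∣ r - s ∣ ≤ 1 × 0 < C (1 + s) × p ≤ C (1 + s)
    -- `C 0` is padding below the tail and equals 0, so it cannot be the positive maximum.
    highest zero    hi pos (inj₁ eq) = contradiction (trans (top≡ 0) eq) (>⇒≢ pos)
    highest (suc r) hi pos (inj₁ eq) = r , subst (_≤ 1) (∣-∣-comm r (suc r)) (∣n-1+n∣≤1 r) ,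
      subst (0 <_) (trans (top≡ (suc r)) eq) pos , subst (p ≤_) (trans (top≡ (suc r)) eq) hi
    highest r hi pos (inj₂ (inj₁ eq)) = r , subst (_≤ 1) (sym (∣n-n∣≡0 r)) z≤n ,
      subst (0 <_) (trans (top≡ r) eq) pos , subst (p ≤_) (trans (top≡ r) eq) hi
    highest r hi pos (inj₂ (inj₂ eq)) = suc r , ∣n-1+n∣≤1 r ,
      subst (0 <_) (trans (top≡ r) eq) pos , subst (p ≤_) (trans (top≡ r) eq) hi

-- Envelopes are bubbles

maxRow : List ℕ → ℕ
maxRow = foldr _⊔_ 0

rowAt≤maxRow : ∀ as i → rowAt as i ≤ maxRow as
rowAt≤maxRow []       i       = z≤n
rowAt≤maxRow (a ∷ as) zero    = m≤m⊔n a _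
rowAt≤maxRow (a ∷ as) (suc i) = ≤-trans (rowAt≤maxRow as i) (m≤n⊔m a _)

maxRow-attained : ∀ as → ∃[ i ] rowAt as i ≡ maxRow as
maxRow-attained [] = 0 , refl
maxRow-attained (a ∷ as) with ⊔-sel a (maxRow as)
... | inj₁ eq = 0 , sym eq
... | inj₂ eq with i , eq′ ← maxRow-attained as = suc i , trans eq′ (sym eq)

column-< : ∀ a {p q} → q < p → a ℤ.- + p ℤ.< a ℤ.- + q
column-< a q<p = ℤₚ.+-monoʳ-< a (ℤₚ.neg-mono-< (ℤ.+<+ q<p))

column-≤ : ∀ a {p q} → q ≤ p → a ℤ.- + p ℤ.≤ a ℤ.- + q
column-≤ a q≤p = ℤₚ.+-monoʳ-≤ a (ℤₚ.neg-mono-≤ (ℤ.+≤+ q≤p))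

column-≤⁻ : ∀ a {p q} → a ℤ.- + p ℤ.≤ a ℤ.- + q → q ≤ p
column-≤⁻ a l = ≮⇒≥ λ p<q → ℤₚ.≤⇒≯ l (column-< a p<q)

column-injective : ∀ a {p q} → a ℤ.- + p ≡ a ℤ.- + q → p ≡ q
column-injective a eq = ≤-antisym (column-≤⁻ a (ℤₚ.≤-reflexive (sym eq))) (column-≤⁻ a (ℤₚ.≤-reflexive eq))

column-leftmost : ∀ a w → (a ℤ.- + 0) ℤ.- + w ≡ a ℤ.- + w
column-leftmost a w = cong (λ k → k ℤ.- + w) (ℤₚ.+-identityʳ a)

module _ (as : List⁺ ℕ) (positive : All (1 ≤_) (toList as))
         (C-ok : NoShortWell (paddedRow (toList as))) where

  private
    o  = envelopeOrigin
    bs = toList as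
    m  = length bs
    C  = paddedRow bs
    ts = turns bs (s≤s z≤n) positive C-ok
    E  = rowAt (0 ∷ ts)

    length-ts : length ts ≡ 2 + m
    length-ts = length-applyUpTo (λ i → C (1 + i) ⊔ C (2 + i)) (2 + m)

  envelope≐surrounds : envelope as ≐ (λ c → ∃[ p ] ∃[ r ] c ≡ at o p r × Surrounds C p r)
  envelope≐surrounds =
    (λ {c} c∈ → depth o c , height o c , envelope-at c∈ ,
                envelope⁻ as (depth o c) (height o c) (subst (envelope as) (envelope-at c∈) c∈)) ,
    λ { (p , r , refl , s) → envelope⁺ as p r s }

  envelope≐pathCells : envelope as ≐ PathCells o 0 ts 0
  envelope≐pathCells =
    (λ c∈ → let p , r , eq , s = proj₁ envelope≐surrounds c∈ in
            p , r , eq , subst (λ n → OnPath E n p r) (sym length-ts) (surrounds⇒onPath bs (s≤s z≤n) positive C-ok s)) ,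
    λ (p , r , eq , b) → proj₂ envelope≐surrounds
      (p , r , eq , onPath⇒surrounds bs (s≤s z≤n) positive C-ok (subst (λ n → OnPath E n p r) length-ts b))

  surrounds-depth≤ : ∀ {p r} → Surrounds C p r → p ≤ maxRow bs
  surrounds-depth≤ (_ , suc s , _ , _ , p≤C) = ≤-trans p≤C (rowAt≤maxRow bs s)

  surrounds-height≤ : ∀ {p r} → Surrounds C p r → r ≤ 1 + m
  surrounds-height≤ s = ≤-pred (proj₁ (surrounds⇒onPath bs (s≤s z≤n) positive C-ok s))

  -- Rows of the bargraph are nonempty and cover the column of the tail, which is therefore free
  -- only just below and just above them.
  surrounds-end : ∀ {r} → Surrounds C 0 r → r ≡ 0 ⊎ r ≡ 1 + m
  surrounds-end {zero}  _ = inj₁ refl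
  surrounds-end {suc r} s@(C≤0 , _) with r <? m
  ... | yes r<m = contradiction C≤0 (<⇒≱ (rowAt-positive positive r<m))
  ... | no  r≮m = inj₂ (cong suc (≤-antisym (≤-pred (surrounds-height≤ {r = suc r} s)) (≮⇒≥ r≮m)))

  -- The witness is the cell just West of a longest row.
  surrounds-widest : 1 ≤ maxRow bs → ∃[ r ] Surrounds C (maxRow bs) r
  surrounds-widest w>0 with i , eq ← maxRow-attained bs =
    1 + i , ≤-reflexive eq , 1 + i , ≤-trans (≤-reflexive (∣n-n∣≡0 i)) z≤n ,
    subst (0 <_) (sym eq) w>0 , ≤-reflexive (sym eq)

  envelope-isBubble : ∀ {h} → 2 ≤ h → maxRow bs ≡ h ∸ 1 → IsBubble h (envelope as)
  envelope-isBubble {h} 2≤h width = record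
    { snake = path⇒snake {o = o} envelope≐pathCells (turns-smooth bs (s≤s z≤n) positive C-ok)
                         enumerates (trace-linked o trace₀)
    ; tail = at o 0 0
    ; head = at o 0 (1 + m)
    ; partiallyDirected = record
      { path       = _
      ; enumerates = enumerates
      ; distinct   = trace-unique o trace₀
      ; steps      = trace-linked o trace₀
      ; first      = refl
      ; last       = last
      }
    ; sameColumn = refl
    ; otherCells = otherCells
    ; reached    = reached
    }
    where
    ∃trace₀ : ∃ (Trace o 0 ts 0)
    ∃trace₀ = ∃-trace o 0 _ _ 0
    cs = proj₁ ∃trace₀
    trace₀ : Trace o 0 ts 0 cs
    trace₀ = proj₂ ∃trace₀

    enumerates : envelope as ≐ (_∈ at o 0 0 ∷ cs)
    enumerates = trace-∈⁺ o trace₀ ∘ proj₁ envelope≐pathCells ,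
                 proj₂ envelope≐pathCells ∘ trace-∈⁻ o trace₀

    last : List.last (at o 0 0 ∷ cs) ≡ just (at o 0 (1 + m))
    -- `C (2 + m)` and `C (3 + m)` lie above the topmost row and are 0, so the path ends in the
    -- column of the tail.
    last with j , eq , last′ ← trace-last o trace₀ = trans last′ (cong just (cong₂ (at o)
      (trans (cong E length-ts) (trans (turns-⊔ bs (s≤s z≤n) positive C-ok (2 + m))
        (cong₂ _⊔_ (rowAt-outside {bs} ≤-refl) (rowAt-outside {bs} (n≤1+n m)))))
      (suc-injective (trans eq length-ts))))

    otherCells : ∀ {c} → envelope as c → c ≢ at o 0 0 → c ≢ at o 0 (1 + m) →
                 column (at o 0 0) ℤ.- + (h ∸ 1) ℤ.≤ column c × column c ℤ.< column (at o 0 0)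
    otherCells c∈ ≢tail ≢head with proj₁ envelope≐surrounds c∈
    ... | zero  , r , refl , s = ⊥-elim
            ([ (λ { refl → ≢tail refl }) , (λ { refl → ≢head refl }) ]′ (surrounds-end {r} s))
    ... | suc p , r , refl , s =
      ℤₚ.≤-trans (ℤₚ.≤-reflexive (column-leftmost 0ℤ (h ∸ 1)))
                 (column-≤ 0ℤ (≤-trans (surrounds-depth≤ {r = r} s) (≤-reflexive width))) ,
      column-< 0ℤ z<s

    reached : ∃[ c ] envelope as c × column c ≡ column (at o 0 0) ℤ.- + (h ∸ 1)
    reached with r , s ← surrounds-widest (≤-trans (∸-monoˡ-≤ 1 2≤h) (≤-reflexive (sym width))) =
      at o (maxRow bs) r , proj₂ envelope≐surrounds (_ , r , refl , s) ,
      trans (cong (λ k → 0ℤ ℤ.- + k) width) (sym (column-leftmost 0ℤ (h ∸ 1)))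

-- Row lengths of stretched bargraphs

All-stretchAbove⁺ : ∀ {P : ℕ → Set} h₀ {as} → All P as → All P (stretchAbove h₀ as)
All-stretchAbove⁺ h₀ [] = []
All-stretchAbove⁺ {P} h₀ {a ∷ as} (pa ∷ ps) with wellStarts? h₀ a as
... | yes w = subst (All P) (sym (stretchAbove-well w)) (pa ∷ pa ∷ pa ∷ All-stretchAbove⁺ a ps)
... | no ¬w = subst (All P) (sym (stretchAbove-¬well ¬w)) (pa ∷ All-stretchAbove⁺ a ps)

All-stretchAbove⁻ : ∀ {P : ℕ → Set} h₀ as → All P (stretchAbove h₀ as) → All P as
All-stretchAbove⁻ h₀ [] [] = []
All-stretchAbove⁻ {P} h₀ (a ∷ as) ps with wellStarts? h₀ a as
... | yes w with pa ∷ _ ∷ _ ∷ ps′ ← subst (All P) (stretchAbove-well w) ps = pa ∷ All-stretchAbove⁻ a as ps′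
... | no ¬w with pa ∷ ps′ ← subst (All P) (stretchAbove-¬well ¬w) ps = pa ∷ All-stretchAbove⁻ a as ps′

maxRow-stretchAbove : ∀ h₀ as → maxRow (stretchAbove h₀ as) ≡ maxRow as
maxRow-stretchAbove h₀ [] = refl
maxRow-stretchAbove h₀ (a ∷ as) with wellStarts? h₀ a as
... | no ¬w = trans (cong maxRow (stretchAbove-¬well ¬w)) (cong (a ⊔_) (maxRow-stretchAbove a as))
... | yes w = begin
  maxRow (stretchAbove h₀ (a ∷ as)) ≡⟨ cong maxRow (stretchAbove-well w) ⟩
  a ⊔ (a ⊔ (a ⊔ M))                 ≡⟨ cong (a ⊔_) (absorb M) ⟩
  a ⊔ (a ⊔ M)                       ≡⟨ absorb M ⟩
  a ⊔ M                             ≡⟨ cong (a ⊔_) (maxRow-stretchAbove a as) ⟩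
  a ⊔ maxRow as                     ∎
  where
  open ≡-Reasoning
  M = maxRow (stretchAbove a as)
  absorb : ∀ k → a ⊔ (a ⊔ k) ≡ a ⊔ k
  absorb k = trans (sym (⊔-assoc a a k)) (cong (_⊔ k) (⊔-idem a))

module _ {w} (b : Bargraph w) where

  stretch-positive : All (1 ≤_) (toList (stretch (rows b)))
  stretch-positive with pa ∷ ps ← positive b = pa ∷ All-stretchAbove⁺ _ ps

  stretch-noShortWell : NoShortWell (paddedRow (toList (stretch (rows b))))
  stretch-noShortWell = tallWells⇒noShortWell
    -- No row is shorter than an empty one, so neither the second padding 0 nor the bottom row
    -- starts a well.
    (¬well (λ ()) (¬well (λ ()) (stretchAbove-tallWells _ (List⁺.tail (rows b)))))
    where
    tallWells⇒noShortWell : ∀ {h₀ as} → TallWells h₀ as → NoShortWell (rowAt (h₀ ∷ as))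
    tallWells⇒noShortWell t = record { height≢1 = tallWells-height≢1 t ; height≢2 = tallWells-height≢2 t }

  stretch-width : maxRow (toList (stretch (rows b))) ≡ w
  stretch-width = trans (cong (List⁺.head (rows b) ⊔_) (maxRow-stretchAbove _ (List⁺.tail (rows b)))) (width b)

f-isBubble : ∀ {h} → 2 ≤ h → (b : Bargraph (h ∸ 1)) → IsBubble h (f b)
f-isBubble 2≤h b = envelope-isBubble _ (stretch-positive b) (stretch-noShortWell b) 2≤h (stretch-width b)

-- Injectivity

-- Positivity marks where the lists end, since the value beyond the end is 0.
rowAt-injective : ∀ {as bs} → All (1 ≤_) as → All (1 ≤_) bs → (∀ i → rowAt as i ≡ rowAt bs i) → as ≡ bs
rowAt-injective []        []        eq = refl
rowAt-injective []        (pb ∷ _)  eq = contradiction (eq 0) (<⇒≢ pb)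
rowAt-injective (pa ∷ _)  []        eq = contradiction (sym (eq 0)) (<⇒≢ pa)
rowAt-injective (_ ∷ pas) (_ ∷ pbs) eq = cong₂ _∷_ (eq 0) (rowAt-injective pas pbs (eq ∘ suc))

surrounds-innermost : ∀ {C p r} → Surrounds C p r → Surrounds C (C (1 + r)) r
surrounds-innermost (C≤p , s , near , pos , p≤C) = ≤-refl , s , near , pos , ≤-trans C≤p p≤C

-- A nonempty row of `C` puts some cell of height `r` into both envelopes. Then the innermost such
-- cell for `D`, at depth `D (1 + r)`, is also in the envelope for `C`, hence outside the bargraph
-- of `C`.
surrounds-⊆⊇⇒≤ : ∀ C D → (∀ p r → Surrounds C p r → Surrounds D p r) →
                 (∀ p r → Surrounds D p r → Surrounds C p r) → ∀ r → C (1 + r) ≤ D (1 + r)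
surrounds-⊆⊇⇒≤ C D C⊆D D⊆C r with C (1 + r) in eq
... | zero  = z≤n
... | suc c = subst (_≤ D (1 + r)) eq (proj₁ (D⊆C _ r (surrounds-innermost {D} {r = r} (C⊆D _ r S))))
  where
  S : Surrounds C (C (1 + r)) r
  S = ≤-refl , r , ≤-trans (≤-reflexive (∣n-n∣≡0 r)) z≤n , subst (0 <_) (sym eq) z<s , ≤-refl

at-row-≥ : ∀ o p r → row o ℤ.≤ row (at o p r)
at-row-≥ o p r = ℤₚ.i≤i+j (row o) (+ r)

envelope-column-≤ : ∀ as {c} → envelope as c → column c ℤ.≤ 0ℤ
envelope-column-≤ as (_ , _ , x≤0) = x≤0

envelope-row-≥ : ∀ as {c} → envelope as c → -1ℤ ℤ.≤ row c
envelope-row-≥ as {c} c∈ = subst (λ d → -1ℤ ℤ.≤ row d) (sym (envelope-at c∈))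
                             (at-row-≥ envelopeOrigin (depth envelopeOrigin c) (height envelopeOrigin c))

envelope-corner : ∀ as → All (1 ≤_) (toList as) → envelope as envelopeOrigin
envelope-corner as (pos ∷ _) = envelope⁺ as 0 0 (z≤n , 1 , ≤-refl , pos , z≤n)

⊕-cancel : ∀ c v → (column c ℤ.- column v , row c ℤ.- row v) ⊕ v ≡ c
⊕-cancel (x , y) (vx , vy) = cong₂ _,_ (cancel x vx) (cancel y vy)
  where
  cancel : ∀ i j → i ℤ.- j ℤ.+ j ≡ i
  cancel = solve-∀

⊕-identity : ∀ c → c ⊕ (0ℤ , 0ℤ) ≡ c
⊕-identity (x , y) = cong₂ _,_ (ℤₚ.+-identityʳ x) (ℤₚ.+-identityʳ y)

-- Both envelopes lie in the quadrant with corner `envelopeOrigin` and contain that corner.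
-- Translating it forwards and backwards bounds `v` from both sides.
envelope-translation : ∀ as bs → All (1 ≤_) (toList as) → All (1 ≤_) (toList bs) → ∀ v →
                       envelope as ≐ (λ c → envelope bs (c ⊕ v)) → v ≡ (0ℤ , 0ℤ)
envelope-translation as bs pas pbs v@(vx , vy) (⊆ , ⊇) = cong₂ _,_
  (ℤₚ.≤-antisym
    (subst (ℤ._≤ 0ℤ) (ℤₚ.+-identityˡ vx) (envelope-column-≤ bs from))
    (ℤₚ.neg-cancel-≤ (subst (ℤ._≤ 0ℤ) (ℤₚ.+-identityˡ (- vx)) (envelope-column-≤ as to))))
  (ℤₚ.≤-antisym
    (ℤₚ.neg-cancel-≤ (subst (0ℤ ℤ.≤_) (shift (- vy)) (ℤₚ.+-monoʳ-≤ 1ℤ (envelope-row-≥ as to))))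
    (subst (0ℤ ℤ.≤_) (shift vy) (ℤₚ.+-monoʳ-≤ 1ℤ (envelope-row-≥ bs from))))
  where
  from : envelope bs (envelopeOrigin ⊕ v)
  from = ⊆ (envelope-corner as pas)
  to : envelope as (column envelopeOrigin ℤ.- vx , row envelopeOrigin ℤ.- vy)
  to = ⊇ (subst (envelope bs) (sym (⊕-cancel envelopeOrigin v)) (envelope-corner bs pbs))
  shift : ∀ i → 1ℤ ℤ.+ (-1ℤ ℤ.+ i) ≡ i
  shift = solve-∀

envelope-injective : ∀ as bs → All (1 ≤_) (toList as) → All (1 ≤_) (toList bs) →
                     envelope as ≈ₜ envelope bs → toList as ≡ toList bs
envelope-injective as bs pas pbs (v , as≐bs) =
  rowAt-injective pas pbs λ i → ≤-antisym (surrounds-⊆⊇⇒≤ C D ⊆ ⊇ (suc i)) (surrounds-⊆⊇⇒≤ D C ⊇ ⊆ (suc i))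
  where
  C = paddedRow (toList as)
  D = paddedRow (toList bs)
  ⊕v : ∀ c → c ⊕ v ≡ c
  ⊕v c = trans (cong (c ⊕_) (envelope-translation as bs pas pbs v as≐bs)) (⊕-identity c)
  ⊆ : ∀ p r → Surrounds C p r → Surrounds D p r
  ⊆ p r S = envelope⁻ bs p r (subst (envelope bs) (⊕v _) (proj₁ as≐bs (envelope⁺ as p r S)))
  ⊇ : ∀ p r → Surrounds D p r → Surrounds C p r
  ⊇ p r S = envelope⁻ as p r (proj₂ as≐bs (subst (envelope bs) (sym (⊕v _)) (envelope⁺ bs p r S)))

f-injective : ∀ {w} (b b′ : Bargraph w) → f b ≈ₜ f b′ → b ≈ᵍ b′
f-injective b b′ fb≈fb′
  with refl , tails ← ∷-injective (envelope-injective (stretch (rows b)) (stretch (rows b′))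
                                    (stretch-positive b) (stretch-positive b′) fb≈fb′)
  = cong (List⁺.head (rows b) ∷_) (stretchAbove-injective _ _ _ tails)

-- Surjectivity

square-cycle : ∀ o {P p r} → P (at o p r) → P (at o (suc p) r) → P (at o p (suc r)) →
               P (at o (suc p) (suc r)) → Cycle P
square-cycle o {P} {p} {r} sw se nw ne = record
  { start    = at o p r
  ; others   = at o (suc p) r ∷ at o (suc p) (suc r) ∷ at o p (suc r) ∷ []
  ; distinct = (depth≢ (λ ()) ∷ depth≢ (λ ()) ∷ height≢ (λ ()) ∷ []) ∷
               (height≢ (λ ()) ∷ height≢ (λ ()) ∷ []) ∷
               (depth≢ (λ ()) ∷ []) ∷ [] ∷ []
  ; long     = s≤s (s≤s (s≤s z≤n))
  ; closed   = (sw , se , step⇒adjacent (at o p r) (step-west o p r)) ∷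
               (se , ne , step⇒adjacent (at o (suc p) r) (step-north o (suc p) r)) ∷
               (ne , nw , step⇒adjacent (at o (suc p) (suc r)) (step-east o p (suc r))) ∷
               adjacentIn-sym P (at o p r) (at o p (suc r)) (sw , nw , step⇒adjacent (at o p r) (step-north o p r)) ∷ [-]
  }
  where
  depth≢ : ∀ {p q r s} → p ≢ q → at o p r ≢ at o q s
  depth≢ p≢q eq = p≢q (proj₁ (at-injective o eq))
  height≢ : ∀ {p q r s} → r ≢ s → at o p r ≢ at o q s
  height≢ r≢s eq = r≢s (proj₂ (at-injective o eq))

-- A bubble in coordinates centred at its tail, with turning depths `ts`. The head returns to the
-- column of the tail by `closes`; `ends` will make the recovered row lengths positive.
record IsPathOfWidth (w : ℕ) (P : CellSet) (o : Cell) (ts : List ℕ) : Set where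
  field
    enumerates : P ≐ PathCells o 0 ts 0
    acyclic    : ¬ Cycle P
    closes     : rowAt (0 ∷ ts) (length ts) ≡ 0
    ends       : ∀ {r} → P (at o 0 r) → r ≡ 0 ⊎ suc r ≡ length ts
    depth≤     : ∀ {p r} → P (at o p r) → p ≤ w
    widest     : ∃[ r ] P (at o w r)

module _ {w P o ts} (w>0 : 0 < w) (path : IsPathOfWidth w P o ts) where
  open IsPathOfWidth path

  private
    E = rowAt (0 ∷ ts)
    n = length ts

    E-vanish : ∀ {i} → n ≤ i → E i ≡ 0
    E-vanish {i} n≤i with m≤n⇒m<n∨m≡n n≤i
    ... | inj₂ refl = closes
    E-vanish {suc i} n≤i | inj₁ (s≤s n≤i′) = rowAt-outside {ts} n≤i′

    onPath⇒P : ∀ {p r} → OnPath E n p r → P (at o p r)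
    onPath⇒P b = proj₂ enumerates (_ , _ , refl , b)

    P⇒onPath : ∀ {p r} → P (at o p r) → OnPath E n p r
    P⇒onPath c∈ with _ , _ , eq , b ← proj₁ enumerates c∈ with refl , refl ← at-injective o eq = b

  path-smooth : Smooth E
  path-smooth = record { noPeak = noPeak ; noDip = noDip }
    where
    noPeak : ∀ i → E i < E (1 + i) → ¬ E (2 + i) < E (1 + i)
    noPeak i l r with E (1 + i) in eq
    ... | suc e = acyclic (square-cycle o
      (onPath⇒P (i<n , E≤e , ≤-trans (n≤1+n e) e<top))
      (onPath⇒P (i<n , ≤-trans E≤e (n≤1+n e) , e<top))
      (onPath⇒P (1+i<n , E≤e′ , ≤-trans (n≤1+n e) e<top′))
      (onPath⇒P (1+i<n , ≤-trans E≤e′ (n≤1+n e) , e<top′)))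
      where
      -- Turning depths vanish from index `n` on, so a positive one guarantees that both rows of the
      -- square exist.
      1+i<n : 1 + i < n
      1+i<n = ≰⇒> λ n≤ → contradiction (trans (sym eq) (E-vanish n≤)) λ ()
      i<n = <⇒≤ 1+i<n
      E≤e  = ≤-trans (m⊓n≤m (E i) (E (1 + i))) (≤-pred l)
      E≤e′ = ≤-trans (m⊓n≤n (E (1 + i)) (E (2 + i))) (≤-pred r)
      e<top  = ≤-trans (≤-reflexive (sym eq)) (m≤n⊔m (E i) (E (1 + i)))
      e<top′ = ≤-trans (≤-reflexive (sym eq)) (m≤m⊔n (E (1 + i)) (E (2 + i)))

    noDip : ∀ i → E (1 + i) < E i → ¬ E (1 + i) < E (2 + i)
    noDip i l r = acyclic (square-cycle o
      (onPath⇒P (i<n , E≤e , ≤-trans (n≤1+n e) e<top))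
      (onPath⇒P (i<n , ≤-trans E≤e (n≤1+n e) , e<top))
      (onPath⇒P (1+i<n , E≤e′ , ≤-trans (n≤1+n e) e<top′))
      (onPath⇒P (1+i<n , ≤-trans E≤e′ (n≤1+n e) , e<top′)))
      where
      e = E (1 + i)
      1+i<n : 1 + i < n
      1+i<n = ≰⇒> λ n≤ → <⇒≢ (≤-<-trans z≤n r) (sym (E-vanish (m≤n⇒m≤1+n n≤)))
      i<n = <⇒≤ 1+i<n
      E≤e  = m⊓n≤n (E i) e
      E≤e′ = m⊓n≤m e (E (2 + i))
      e<top  = ≤-trans l (m≤m⊔n (E i) e)
      e<top′ = ≤-trans r (m≤n⊔m e (E (2 + i)))

  private
    open Smooth path-smooth

    -- With at most two rows, `E 0` and `E 2` are 0, so `E 1` is a peak or 0 as well; in the latter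
    -- case no cell attains the positive width `w`.
    3≤n : 3 ≤ n
    3≤n = ≮⇒≥ λ { (s≤s n≤2) → tooShort n≤2 }
      where
      tooShort : ¬ n ≤ 2
      tooShort n≤2 with r , c∈ ← widest with r<n , _ , w≤ ← P⇒onPath c∈ = helper (≤-trans r<n n≤2) (<-≤-trans w>0 w≤)
        where
        0<E₁⇒⊥ : ¬ 0 < E 1
        0<E₁⇒⊥ pos = noPeak 0 pos (subst (_< E 1) (sym (E-vanish n≤2)) pos)
        helper : ∀ {r} → r < 2 → ¬ 0 < E r ⊔ E (1 + r)
        helper {zero}     _ pos = 0<E₁⇒⊥ pos
        helper {suc zero} _ pos = 0<E₁⇒⊥ (subst (0 <_) (trans (cong (E 1 ⊔_) (E-vanish n≤2)) (⊔-identityʳ (E 1))) pos)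
        helper {suc (suc r)} (s≤s (s≤s ()))

    -- The first and last rows of the bubble lie outside the bargraph, and the bottom row of the
    -- bargraph is split off as the head of `innerRows`.
    m = n ∸ 3

    n≡3+m : n ≡ 3 + m
    n≡3+m = sym (m+[n∸m]≡n 3≤n)

    rowLength : ℕ → ℕ
    rowLength i = E (1 + i) ⊓ E (2 + i)

  innerRows : List⁺ ℕ
  innerRows = rowLength 0 ∷ applyUpTo (rowLength ∘ suc) m

  private
    C = paddedRow (toList innerRows)

    C≡ : ∀ i → C (1 + i) ≡ E i ⊓ E (1 + i)
    C≡ zero    = refl
    C≡ (suc i) = rowAt-applyUpTo rowLength (1 + m) vanish i
      where
      vanish : ∀ i → 1 + m ≤ i → rowLength i ≡ 0
      vanish i m<i = trans (cong (E (1 + i) ⊓_) (E-vanish (≤-trans (≤-reflexive n≡3+m) (s≤s (s≤s m<i)))))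
                           (⊓-zeroʳ (E (1 + i)))

  innerRows-noShortWell : NoShortWell C
  innerRows-noShortWell = ⊓-noShortWell refl refl C≡ path-smooth

  innerRows-positive : All (1 ≤_) (toList innerRows)
  innerRows-positive = applyUpTo⁺₁ rowLength (1 + m) pos
    where
    pos : ∀ {i} → i < 1 + m → 1 ≤ rowLength i
    -- A vanishing row length would put a cell into the column of the tail, in a row that is neither
    -- the first nor the last.
    pos {i} i<1+m = n≢0⇒n>0 λ eq → ¬end (ends (subst (λ p → P (at o p (1 + i))) eq
      (onPath⇒P (1+i<n , ≤-refl , ≤-trans (m⊓n≤m (E (1 + i)) _) (m≤m⊔n _ _)))))
      where
      1+i<n : 1 + i < n
      1+i<n = ≤-trans (s≤s (≤-trans i<1+m (n≤1+n _))) (≤-reflexive (sym n≡3+m))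
      ¬end : ¬ (1 + i ≡ 0 ⊎ 2 + i ≡ n)
      ¬end (inj₂ eq) = <⇒≢ i<1+m (suc-injective (suc-injective (trans eq n≡3+m)))

  private
    -- Carries the description of envelopes, stated for `turns`, over to the turning depths of `P`.
    E≗ : ∀ k → rowAt (0 ∷ turns (toList innerRows) (s≤s z≤n) innerRows-positive innerRows-noShortWell) k ≡ E k
    E≗ k = trans (turns-⊔ (toList innerRows) (s≤s z≤n) innerRows-positive innerRows-noShortWell k)
                   (sym (⊔-of-⊓ {C} refl refl C≡ path-smooth k))

    n≡ : 2 + length (toList innerRows) ≡ n
    n≡ = trans (cong (λ k → 3 + k) (length-applyUpTo (rowLength ∘ suc) m)) (sym n≡3+m)

  surrounds⇒P : ∀ {p r} → Surrounds C p r → P (at o p r)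
  surrounds⇒P {p} {r} S
    with r<n , b ← surrounds⇒onPath (toList innerRows) (s≤s z≤n) innerRows-positive innerRows-noShortWell S =
    onPath⇒P (subst (r <_) n≡ r<n , subst₂ (λ e e′ → Between e e′ p) (E≗ r) (E≗ (1 + r)) b)

  P⇒surrounds : ∀ {p r} → P (at o p r) → Surrounds C p r
  P⇒surrounds {p} {r} c∈ with r<n , b ← P⇒onPath c∈ =
    onPath⇒surrounds (toList innerRows) (s≤s z≤n) innerRows-positive innerRows-noShortWell
      (subst (r <_) (sym n≡) r<n , subst₂ (λ e e′ → Between e e′ p) (sym (E≗ r)) (sym (E≗ (1 + r))) b)

  innerRows-width : maxRow (toList innerRows) ≡ w
  innerRows-width = ≤-antisym
    (let r , S = surrounds-widest innerRows innerRows-positive innerRows-noShortWell (≤-trans w>0 w≤) in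
     depth≤ (surrounds⇒P {r = r} S))
    w≤
    where
    w≤ : w ≤ maxRow (toList innerRows)
    w≤ = surrounds-depth≤ innerRows innerRows-positive innerRows-noShortWell {r = proj₁ widest} (P⇒surrounds (proj₂ widest))

  envelope-innerRows : envelope innerRows ≈ₜ P
  envelope-innerRows = v , (λ c∈ → to (proj₁ env c∈)) , from
    where
    env = envelope≐surrounds innerRows innerRows-positive innerRows-noShortWell
    v : Cell
    -- Moves `envelopeOrigin`, which lies in row -1, to `o`.
    v = column o , row o ℤ.+ 1ℤ
    translate : ∀ p r → at envelopeOrigin p r ⊕ v ≡ at o p r
    translate p r = cong₂ _,_ (shiftˡ (+ p) (column o)) (shiftʳ (+ r) (row o))
      where
      shiftˡ : ∀ p a → 0ℤ ℤ.- p ℤ.+ a ≡ a ℤ.- p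
      shiftˡ = solve-∀
      shiftʳ : ∀ r b → -1ℤ ℤ.+ r ℤ.+ (b ℤ.+ 1ℤ) ≡ b ℤ.+ r
      shiftʳ = solve-∀
    ⊕-cancelʳ : ∀ {c d} → c ⊕ v ≡ d ⊕ v → c ≡ d
    ⊕-cancelʳ eq = cong₂ _,_ (∙-cancelʳ _ _ _ (cong column eq)) (∙-cancelʳ _ _ _ (cong row eq))
    to : ∀ {c} → (∃[ p ] ∃[ r ] c ≡ at envelopeOrigin p r × Surrounds C p r) → P (c ⊕ v)
    to (p , r , refl , S) = subst P (sym (translate p r)) (surrounds⇒P S)
    from : ∀ {c} → P (c ⊕ v) → envelope innerRows c
    from c∈ with p , r , eq , b ← proj₁ enumerates c∈ =
      proj₂ env (p , r , ⊕-cancelʳ (trans eq (sym (translate p r))) , P⇒surrounds (onPath⇒P b))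

  -- Since `innerRows` has no short well, it is already stretched; merging the tripled rows gives
  -- the preimage.
  path-preimage : Σ (Bargraph w) λ b → f b ≈ₜ P
  path-preimage
    with as , eq ← unstretchAbove (tallWells-unground
           (noShortWell⇒tallWells 0 (toList innerRows) (noShortWell-tail innerRows-noShortWell))) = b ,
      subst (λ bs → envelope (rowLength 0 ∷ bs) ≈ₜ P) (sym eq) envelope-innerRows
    where
    b : Bargraph w
    b = record
      { rows     = rowLength 0 ∷ as
      ; positive = All.head innerRows-positive ∷
                   All-stretchAbove⁻ _ as (subst (All (1 ≤_)) (sym eq) (All.tail innerRows-positive))
      ; width    = trans (cong (rowLength 0 ⊔_) (trans (sym (maxRow-stretchAbove (rowLength 0) as)) (cong maxRow eq)))
                         innerRows-width
      }

-- From bubbles to turning depths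

_≟ᶜ_ : (c d : Cell) → Dec (c ≡ d)
_≟ᶜ_ = ≡-dec ℤₚ._≟_ ℤₚ._≟_

module _ {h} (2≤h : 2 ≤ h) {P} (bubble : IsBubble h P) where
  open IsBubble bubble
  open PartiallyDirected partiallyDirected

  private
    column≤tail : ∀ {c} → P c → column c ℤ.≤ column tail
    column≤tail {c} c∈ with c ≟ᶜ tail | c ≟ᶜ head
    ... | yes refl  | _         = ℤₚ.≤-refl
    ... | no _      | yes refl  = ℤₚ.≤-reflexive (sym sameColumn)
    ... | no c≢tail | no c≢head = ℤₚ.<⇒≤ (proj₂ (otherCells c∈ c≢tail c≢head))

    leftmost≤column : ∀ {c} → P c → leftmost ℤ.≤ column c
    leftmost≤column {c} c∈ with c ≟ᶜ tail | c ≟ᶜ head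
    ... | yes refl  | _         = ℤₚ.i-j≤i (column tail) (+ (h ∸ 1))
    ... | no _      | yes refl  = subst (leftmost ℤ.≤_) sameColumn (ℤₚ.i-j≤i (column tail) (+ (h ∸ 1)))
    ... | no c≢tail | no c≢head = proj₁ (otherCells c∈ c≢tail c≢head)

    rightmost⇒end : ∀ {c} → P c → column c ≡ column tail → c ≡ tail ⊎ c ≡ head
    rightmost⇒end {c} c∈ eq with c ≟ᶜ tail | c ≟ᶜ head
    ... | yes c≡tail | _          = inj₁ c≡tail
    ... | no _       | yes c≡head = inj₂ c≡head
    ... | no c≢tail  | no c≢head  =
      contradiction (proj₂ (otherCells c∈ c≢tail c≢head)) (ℤₚ.<-irrefl eq)

    traced : ∃[ d ] ∃[ ds ] ∃[ cs ] path ≡ at tail 0 0 ∷ cs × Trace tail 0 (d ∷ ds) 0 cs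
    traced = go path first steps distinct λ c∈ → column≤tail (proj₂ enumerates c∈)
      where
      go : ∀ cs → List.head cs ≡ just tail → Linked Step cs → Unique cs →
           (∀ {c} → c ∈ cs → column c ℤ.≤ column tail) →
           ∃[ d ] ∃[ ds ] ∃[ cs′ ] cs ≡ at tail 0 0 ∷ cs′ × Trace tail 0 (d ∷ ds) 0 cs′
      go (c ∷ cs) refl l u ≤tail
        with d , ds , t ← parse tail cs (sym (at-origin tail)) l u (All.tabulate (≤tail ∘ there)) =
        d , ds , cs , cong (_∷ cs) (sym (at-origin tail)) , t

  trace⇒isPathOfWidth : ∀ {ts cs} → path ≡ at tail 0 0 ∷ cs → Trace tail 0 ts 0 cs →
                        IsPathOfWidth (h ∸ 1) P tail ts
  trace⇒isPathOfWidth {ts} {cs} path≡ t with j , j≡ , last≡ ← trace-last tail t = record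
    { enumerates = P≐
    ; acyclic    = IsSnake.acyclic snake
    ; closes     = column-injective (column tail) {rowAt (0 ∷ ts) (length ts)} {0} (trans (cong column (sym head≡))
                     (trans (sym sameColumn) (sym (ℤₚ.+-identityʳ (column tail)))))
    ; ends       = λ c∈ → [ inj₁ ∘ isTail , inj₂ ∘ isHead ]′ (rightmost⇒end c∈ (ℤₚ.+-identityʳ (column tail)))
    ; depth≤     = λ c∈ → column-≤⁻ (column tail)
                     (leftmost≤column c∈)
    ; widest     = widest reached
    }
    where
    P≐ : P ≐ PathCells tail 0 ts 0
    P≐ = trace-∈⁻ tail t ∘ subst (_ ∈_) path≡ ∘ proj₁ enumerates ,
         proj₂ enumerates ∘ subst (_ ∈_) (sym path≡) ∘ trace-∈⁺ tail t

    head≡ : head ≡ at tail (rowAt (0 ∷ ts) (length ts)) j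
    head≡ = just-injective (trans (sym last) (trans (cong List.last path≡) last≡))

    isTail : ∀ {r} → at tail 0 r ≡ tail → r ≡ 0
    isTail eq = proj₂ (at-injective tail {0} {0} (trans eq (sym (at-origin tail))))

    isHead : ∀ {r} → at tail 0 r ≡ head → suc r ≡ length ts
    isHead eq = trans (cong suc (proj₂ (at-injective tail {0} {rowAt (0 ∷ ts) (length ts)} (trans eq head≡)))) j≡

    widest : (∃[ c ] P c × column c ≡ leftmost) → ∃[ r ] P (at tail (h ∸ 1) r)
    widest (c , c∈ , column≡) with p , r , refl , _ ← proj₁ P≐ c∈ =
      r , subst (λ p → P (at tail p r)) (column-injective (column tail) {p} {h ∸ 1} column≡) c∈

  bubble-path : ∃[ ts ] IsPathOfWidth (h ∸ 1) P tail ts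
  bubble-path with d , ds , cs , path≡ , t ← traced = d ∷ ds , trace⇒isPathOfWidth path≡ t

f-surjective : ∀ {h} → 2 ≤ h → (y : Bubble h) → Σ (Bargraph (h ∸ 1)) λ b → f b ≈ₜ proj₁ y
f-surjective 2≤h (P , bubble) with ts , path ← bubble-path 2≤h bubble =
  path-preimage (∸-monoˡ-≤ 1 2≤h) path

-- Equality up to translation, and the bijection

≈ₜ-refl : ∀ {P} → P ≈ₜ P
≈ₜ-refl {P} = (0ℤ , 0ℤ) , subst P (sym (⊕-identity _)) , subst P (⊕-identity _)

≈ₜ-sym : ∀ {P Q} → P ≈ₜ Q → Q ≈ₜ P
≈ₜ-sym {P} {Q} (v , P⊆Q , Q⊆P) = v⁻¹ ,
  (λ c∈ → Q⊆P (subst Q (sym (inverse _)) c∈)) , λ c∈ → subst Q (inverse _) (P⊆Q c∈)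
  where
  v⁻¹ : Cell
  v⁻¹ = - column v , - row v
  inverse : ∀ c → c ⊕ v⁻¹ ⊕ v ≡ c
  inverse c = ⊕-cancel c v

≈ₜ-trans : ∀ {P Q R} → P ≈ₜ Q → Q ≈ₜ R → P ≈ₜ R
≈ₜ-trans {P} {Q} {R} (v , P⊆Q , Q⊆P) (u , Q⊆R , R⊆Q) = v ⊕ u ,
  (λ {c} c∈ → subst R (assoc c) (Q⊆R (P⊆Q c∈))) , λ {c} c∈ → Q⊆P (R⊆Q (subst R (sym (assoc c)) c∈))
  where
  assoc : ∀ c → c ⊕ v ⊕ u ≡ c ⊕ (v ⊕ u)
  assoc (x , y) = cong₂ _,_ (ℤₚ.+-assoc x (column v) (column u)) (ℤₚ.+-assoc y (row v) (row u))

f-cong : ∀ {w} {b b′ : Bargraph w} → b ≈ᵍ b′ → f b ≈ₜ f b′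
f-cong {b = b} eq = subst (λ as → f b ≈ₜ envelope (stretch as)) eq ≈ₜ-refl

proposition11 : (h : ℕ) → 2 ≤ h →
    Σ ((b : Bargraph (h ∸ 1)) → IsBubble h (f b)) λ isBubble →
    IsBijection _≈ᵍ_ _≈ᵇ_ (λ b → (f b , isBubble b))
proposition11 h 2≤h = f-isBubble 2≤h , record
  { isInjection = record
    { isCongruent = record
      { cong           = λ {b} {b′} → f-cong {b = b} {b′}
      ; isEquivalence₁ = record { refl = refl ; sym = sym ; trans = trans }
      ; isEquivalence₂ = record { refl = ≈ₜ-refl ; sym = ≈ₜ-sym
                                ; trans = λ {x} {y} {z} → ≈ₜ-trans {proj₁ x} {proj₁ y} {proj₁ z} }
      }
    ; injective = λ {b} {b′} → f-injective b b′
    }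
  ; surjective = λ y → let b , fb≈y = f-surjective 2≤h y in
      b , λ {b′} b′≈b → ≈ₜ-trans {R = proj₁ y} (f-cong {b = b′} {b} b′≈b) fb≈y
  }
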